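{- Let $G$ be a finite graph with a perfect matching. Then $mp_f(G)=1/L(G)$.
   Context: Let $\mathcal{M}(G)$ be the set of perfect matchings of $G$, and for $S\subseteq E(G)$ let $\bm{q}^S\in\mathbb{R}^{E(G)}$ be its incidence vector (entry $1$ at $e\in S$, $0$ otherwise). The fractional matching preclusion number $mp_f(G)$ is the optimal value of the linear program: minimize $\bm{1}^T\bm{y}$ over $\bm{y}\in\mathbb{R}^{E(G)}$ subject to $(\bm{q}^M)^T\bm{y}\geqslant 1$ for every $M\in\mathcal{M}(G)$ and $\bm{y}\geqslant 0$. For a vertex $v$, $\bm{\partial}_G(v)$ is the row vector (incidence vector) of the set of edges incident with $v$. For $X\subseteq V(G)$, the edge cut $\partial_G(X)$ is the set of edges with exactly one end in $X$; it is an odd cut if $|X|$ and $|V(G)\setminus X|$ are both odd, and it is trivial if $|X|=1$ or $|V(G)\setminus X|=1$. $L(G)$ is the optimal value of the linear program (LP) in variables $z\in\mathbb{R}$, $\bm{b}\in\mathbb{R}^{E(G)}$: minimize $z$ subject to $z-b_e\geqslant 0$ for every $e\in E(G)$; $\bm{\partial}_G(v)\bm{b}=1$ for every $v\in V(G)$; $(\bm{q}^C)^T\bm{b}\geqslant 1$ for every non-trivial odd cut $C$ of $G$; $\bm{b}\geqslant 0$.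
   Formalization: The variables of both linear programs range over rational vectors instead of real ones; since all data are rational and rational points are dense in the feasible sets, the optimal values are the same. The graph is taken simple and nonempty. -}

module Defs where

open import Data.Nat as ℕ using (ℕ; zero; suc)
open import Data.Nat.DivMod using (_%_)
open import Data.Fin using (Fin; zero; suc)
open import Data.Bool using (Bool; true; false; _∧_; _∨_; _xor_; if_then_else_)
open import Data.Sum using (_⊎_)
open import Data.Product using (Σ; ∃; _×_; _,_; proj₁; proj₂)
open import Data.Rational using (ℚ; 0ℚ; 1ℚ; _+_; _≤_)
open import Relation.Binary.PropositionalEquality using (_≡_; _≢_)
open import Relation.Nullary.Decidable using (⌊_⌋)
import Data.Fin as F

record Graph (n m : ℕ) : Set where
  field
    ends     : Fin m → Fin n × Fin n
    loopless : ∀ e → proj₁ (ends e) ≢ proj₂ (ends e)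
    simple   : ∀ e f →
      (proj₁ (ends e) ≡ proj₁ (ends f) × proj₂ (ends e) ≡ proj₂ (ends f)) ⊎
      (proj₁ (ends e) ≡ proj₂ (ends f) × proj₂ (ends e) ≡ proj₁ (ends f)) →
      e ≡ f
open Graph public

sumℕ : ∀ {k} → (Fin k → ℕ) → ℕ
sumℕ {zero}  f = 0
sumℕ {suc k} f = f zero ℕ.+ sumℕ (λ i → f (suc i))

sumℚ : ∀ {k} → (Fin k → ℚ) → ℚ
sumℚ {zero}  f = 0ℚ
sumℚ {suc k} f = f zero + sumℚ (λ i → f (suc i))

Subset : ℕ → Set
Subset k = Fin k → Bool

card : ∀ {k} → Subset k → ℕ
card S = sumℕ (λ i → if S i then 1 else 0)

qdot : ∀ {m} → Subset m → (Fin m → ℚ) → ℚ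
qdot S y = sumℚ (λ e → if S e then y e else 0ℚ)

incident : ∀ {n m} → Graph n m → Fin m → Fin n → Bool
incident G e v = ⌊ v F.≟ proj₁ (ends G e) ⌋ ∨ ⌊ v F.≟ proj₂ (ends G e) ⌋

star : ∀ {n m} → Graph n m → Fin n → Subset m
star G v e = incident G e v

IsPerfectMatching : ∀ {n m} → Graph n m → Subset m → Set
IsPerfectMatching G M = ∀ v → card (λ e → M e ∧ incident G e v) ≡ 1

HasPerfectMatching : ∀ {n m} → Graph n m → Set
HasPerfectMatching G = ∃ λ M → IsPerfectMatching G M

cut : ∀ {n m} → Graph n m → Subset n → Subset m
cut G X e = X (proj₁ (ends G e)) xor X (proj₂ (ends G e))

Odd : ℕ → Set
Odd k = k % 2 ≡ 1

IsNontrivialOddCutSide : ∀ {n m} → Graph n m → Subset n → Set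
IsNontrivialOddCutSide {n} G X =
  Odd (card X) × Odd (n ℕ.∸ card X) × card X ≢ 1 × (n ℕ.∸ card X) ≢ 1

IsOptimalValue : {A : Set} → (A → Set) → (A → ℚ) → ℚ → Set
IsOptimalValue {A} Feasible obj v =
  (Σ A λ x → Feasible x × obj x ≡ v) × (∀ x → Feasible x → v ≤ obj x)

MpfFeasible : ∀ {n m} → Graph n m → (Fin m → ℚ) → Set
MpfFeasible G y =
  (∀ M → IsPerfectMatching G M → 1ℚ ≤ qdot M y) × (∀ e → 0ℚ ≤ y e)

mpfObjective : ∀ {m} → (Fin m → ℚ) → ℚ
mpfObjective y = sumℚ y

LFeasible : ∀ {n m} → Graph n m → ℚ × (Fin m → ℚ) → Set
LFeasible G (z , b) =
  (∀ e → b e ≤ z) ×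
  (∀ v → qdot (star G v) b ≡ 1ℚ) ×
  (∀ X → IsNontrivialOddCutSide G X → 1ℚ ≤ qdot (cut G X) b) ×
  (∀ e → 0ℚ ≤ b e)

LObjective : ∀ {m} → ℚ × (Fin m → ℚ) → ℚ
LObjective (z , b) = z

{-# OPTIONS --safe #-}

-- Strong duality for the packing/covering pair of the perfect matching matrix gives an
-- optimal y and optimal multipliers λ on the perfect matchings with Σ y = Σ λ = T.  The
-- average of the matchings with weights λ / T is feasible for (LP) with z = 1 / T.
-- Conversely Edmonds' polytope theorem puts every feasible b above some perfect matching
-- for the cost y, so 1 ≤ y · b ≤ z T.
--
-- Edmonds' theorem is proved by induction on the number of vertices and the support of b:
-- at a tight nontrivial odd cut the graph is contracted on both sides and the matchings
-- are glued along a cut edge; otherwise b moves along a cost-decreasing direction in the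
-- kernel of the incidence matrix until an edge leaves the support or a cut becomes tight.
module Submission where

open import Defs
open import Algebra.Bundles using (module CommutativeRing)
import Algebra.Properties.CommutativeSemigroup as CommutativeSemigroupProperties
open import Data.Bool using (Bool; true; false; not; _∧_; _∨_; _xor_; if_then_else_)
import Data.Bool.Properties as Boolₚ
open import Data.Bool.Properties using (xor-identityʳ; xor-same; ∧-zeroʳ; ∧-identityʳ; ∧-distribˡ-xor;
  not-distribˡ-xor; not-involutive; xor-∧-commutativeRing)
open import Data.Empty using (⊥; ⊥-elim)
open import Data.Fin as F using (Fin; zero; suc; _↑ˡ_; _↑ʳ_)
import Data.Fin.Properties as Fₚ
open import Data.List using ([]; _∷_)
open import Data.Maybe using (Maybe; just; nothing)
open import Data.Nat as ℕ using (ℕ; zero; suc)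
open import Data.Nat.Induction using (<-wellFounded)
import Data.Nat.Properties as ℕₚ
open import Data.Product using (∃; ∃-syntax; ∃₂; _×_; _,_; proj₁; proj₂)
open import Data.Rational
  using (ℚ; 0ℚ; 1ℚ; _+_; _*_; _-_; -_; _≤_; _<_; 1/_; ≢-nonZero; nonNegative; positive)
open import Data.Rational.Properties
open import Data.Sum using (_⊎_; inj₁; inj₂; [_,_]′)
open import Data.Unit using (⊤; tt)
open import Data.Vec.Functional using (_++_)
open import Data.Vec.Functional.Properties using (lookup-++ˡ; lookup-++ʳ)
open import Function using (_∘_; case_of_)
open import Induction.WellFounded using (Acc; acc)
open import Relation.Binary.Definitions using (Tri; tri<; tri≈; tri>)
open import Relation.Binary.PropositionalEquality
open import Relation.Nullary using (Dec; yes; no; ¬_; ¬?; _×-dec_; _⊎-dec_; _→-dec_)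
open import Relation.Nullary.Decidable using (⌊_⌋; decidable-stable; from-yes)
open import Tactic.RingSolver using (solve-∀; solve)
open import Tactic.RingSolver.Core.AlmostCommutativeRing using (AlmostCommutativeRing; fromCommutativeRing)

-- Why a direction in the kernel exists: the degree conditions are one equation per vertex. If every
-- vertex meets at least three edges of the support of b, the support has more edges than there are
-- vertices, so these equations have a nonzero solution living on the support. A vertex with at most
-- two support edges lies instead in a set of three vertices whose cut is tight. Such a cut is
-- nontrivial only if at least three vertices remain outside, so graphs with two or four vertices,
-- which have no nontrivial odd cut, need another source of directions: a perfect matching M in the
-- support is found by hand, and the difference of its incidence vector and b is the direction.
-- Every search ranges over finitely many edges or subsets and all numbers are rational, so the
-- argument is constructive. At least one vertex is required: in the graph without vertices the
-- empty matching is perfect and no y covers it.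

ℚ-ring : AlmostCommutativeRing _ _
ℚ-ring = fromCommutativeRing +-*-commutativeRing isZero
  where
  isZero : ∀ x → Maybe (0ℚ ≡ x)
  isZero x with 0ℚ ≟ x
  ... | yes p = just p
  ... | no _  = nothing

-- Rational order arithmetic

≤-slack : ∀ {p q} d → 0ℚ ≤ d → q ≡ p + d → p ≤ q
≤-slack {p} d 0≤d refl = subst (_≤ p + d) (+-identityʳ p) (+-monoʳ-≤ p 0≤d)

<-slack : ∀ {p q} d → 0ℚ < d → q ≡ p + d → p < q
<-slack {p} d 0<d refl = subst (_< p + d) (+-identityʳ p) (+-monoʳ-< p 0<d)

0≤-diff : ∀ {p q} → p ≤ q → 0ℚ ≤ q - p
0≤-diff {p} {q} p≤q = subst (_≤ q - p) (+-inverseʳ p) (+-monoˡ-≤ (- p) p≤q)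

0<-diff : ∀ {p q} → p < q → 0ℚ < q - p
0<-diff {p} {q} p<q = subst (_< q - p) (+-inverseʳ p) (+-monoˡ-< (- p) p<q)

0≤+ : ∀ {p q} → 0ℚ ≤ p → 0ℚ ≤ q → 0ℚ ≤ p + q
0≤+ = +-mono-≤

0≤* : ∀ {p q} → 0ℚ ≤ p → 0ℚ ≤ q → 0ℚ ≤ p * q
0≤* {p} {q} 0≤p 0≤q =
  subst (_≤ p * q) (*-zeroʳ p) (*-monoˡ-≤-nonNeg p ⦃ nonNegative 0≤p ⦄ 0≤q)

0<* : ∀ {p q} → 0ℚ < p → 0ℚ < q → 0ℚ < p * q
0<* {p} {q} 0<p 0<q =
  subst (_< p * q) (*-zeroʳ p) (*-monoʳ-<-pos p ⦃ positive 0<p ⦄ 0<q)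

0<1 : 0ℚ < 1ℚ
0<1 = positive⁻¹ 1ℚ

0<neg : ∀ {p} → p < 0ℚ → 0ℚ < - p
0<neg {p} p<0 = subst (0ℚ <_) (+-identityˡ (- p)) (0<-diff p<0)

-- The value at 0 is junk.
inv : ℚ → ℚ
inv p with p ≟ 0ℚ
... | yes _  = 0ℚ
... | no p≢0 = (1/ p) ⦃ ≢-nonZero p≢0 ⦄

*-inv : ∀ p → p ≢ 0ℚ → p * inv p ≡ 1ℚ
*-inv p p≢0 with p ≟ 0ℚ
... | yes p≡0 = ⊥-elim (p≢0 p≡0)
... | no p≢0′ = *-inverseʳ p ⦃ ≢-nonZero p≢0′ ⦄

inv-pos : ∀ p → 0ℚ < p → 0ℚ < inv p
inv-pos p 0<p with p ≟ 0ℚ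
... | yes p≡0 = ⊥-elim (<-irrefl (sym p≡0) 0<p)
... | no  p≢0 = positive⁻¹ ((1/ p) ⦃ ≢-nonZero p≢0 ⦄) ⦃ 1/pos⇒pos p ⦃ positive 0<p ⦄ ⦄

reciprocal-pos : ∀ p → 0ℚ < p → ∃[ r ] p * r ≡ 1ℚ × 0ℚ < r
reciprocal-pos p 0<p = inv p , *-inv p (≢-sym (<⇒≢ 0<p)) , inv-pos p 0<p

*-cancelˡ-≤ : ∀ {p q} r → 0ℚ < r → r * p ≤ r * q → p ≤ q
*-cancelˡ-≤ r 0<r = *-cancelˡ-≤-pos r ⦃ positive 0<r ⦄

-- Finite sums

sum-cong : ∀ {k} {f g : Fin k → ℚ} → (∀ i → f i ≡ g i) → sumℚ f ≡ sumℚ g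
sum-cong {zero}  eq = refl
sum-cong {suc k} eq = cong₂ _+_ (eq zero) (sum-cong (eq ∘ suc))

sum-0 : ∀ k → sumℚ {k} (λ _ → 0ℚ) ≡ 0ℚ
sum-0 zero    = refl
sum-0 (suc k) = trans (+-identityˡ _) (sum-0 k)

sum-+ : ∀ {k} (f g : Fin k → ℚ) → sumℚ (λ i → f i + g i) ≡ sumℚ f + sumℚ g
sum-+ {zero}  f g = refl
sum-+ {suc k} f g = trans (cong (f zero + g zero +_) (sum-+ (f ∘ suc) (g ∘ suc)))
  (interchange (f zero) (g zero) (sumℚ (f ∘ suc)) (sumℚ (g ∘ suc)))
  where
  interchange : ∀ a b c d → a + b + (c + d) ≡ (a + c) + (b + d)
  interchange = solve-∀ ℚ-ring

sum-*ˡ : ∀ {k} c (f : Fin k → ℚ) → sumℚ (λ i → c * f i) ≡ c * sumℚ f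
sum-*ˡ {zero}  c f = sym (*-zeroʳ c)
sum-*ˡ {suc k} c f = trans (cong (c * f zero +_) (sum-*ˡ c (f ∘ suc)))
  (sym (*-distribˡ-+ c (f zero) _))

sum-mono : ∀ {k} {f g : Fin k → ℚ} → (∀ i → f i ≤ g i) → sumℚ f ≤ sumℚ g
sum-mono {zero}  le = ≤-refl
sum-mono {suc k} le = +-mono-≤ (le zero) (sum-mono (le ∘ suc))

sum-≥0 : ∀ {k} {f : Fin k → ℚ} → (∀ i → 0ℚ ≤ f i) → 0ℚ ≤ sumℚ f
sum-≥0 {k} {f} f≥0 = subst (_≤ sumℚ f) (sum-0 k) (sum-mono f≥0)

term≤sum : ∀ {k} {f : Fin k → ℚ} → (∀ i → 0ℚ ≤ f i) → ∀ i → f i ≤ sumℚ f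
term≤sum {suc k} {f} f≥0 zero =
  ≤-slack (sumℚ (f ∘ suc)) (sum-≥0 (f≥0 ∘ suc)) refl
term≤sum {suc k} {f} f≥0 (suc i) =
  ≤-trans (term≤sum (f≥0 ∘ suc) i) (≤-slack (f zero) (f≥0 zero) (+-comm (f zero) _))

sum-swap : ∀ {j k} (f : Fin j → Fin k → ℚ) →
  sumℚ (λ a → sumℚ (f a)) ≡ sumℚ (λ b → sumℚ (λ a → f a b))
sum-swap {zero}  {k} f = sym (sum-0 k)
sum-swap {suc j} {k} f = trans (cong (sumℚ (f zero) +_) (sum-swap (f ∘ suc)))
  (sym (sum-+ (f zero) (λ b → sumℚ (λ a → f (suc a) b))))

sum-single : ∀ {k} (f : Fin k → ℚ) i → (∀ j → j ≢ i → f j ≡ 0ℚ) → sumℚ f ≡ f i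
sum-single {suc k} f zero off =
  trans (cong (f zero +_) (trans (sum-cong (λ j → off (suc j) λ ())) (sum-0 k)))
        (+-identityʳ (f zero))
sum-single {suc k} f (suc i) off =
  trans (cong₂ _+_ (off zero λ ()) (sum-single (f ∘ suc) i λ j j≢i → off (suc j) (j≢i ∘ Fₚ.suc-injective)))
        (+-identityˡ _)

-- Inner products

Point : ℕ → Set
Point k = Fin k → ℚ

dot : ∀ {k} → Point k → Point k → ℚ
dot x y = sumℚ (λ i → x i * y i)

dot-cong : ∀ {k} {x x′ y y′ : Fin k → ℚ} → (∀ i → x i ≡ x′ i) → (∀ i → y i ≡ y′ i) →
  dot x y ≡ dot x′ y′
dot-cong ex ey = sum-cong (λ i → cong₂ _*_ (ex i) (ey i))

dot-comm : ∀ {k} (x y : Fin k → ℚ) → dot x y ≡ dot y x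
dot-comm x y = sum-cong (λ i → *-comm (x i) (y i))

dot-linʳ : ∀ {k} (x : Fin k → ℚ) s (y : Fin k → ℚ) t (z : Fin k → ℚ) →
  dot x (λ i → s * y i + t * z i) ≡ s * dot x y + t * dot x z
dot-linʳ x s y t z = begin
  dot x (λ i → s * y i + t * z i)
    ≡⟨ sum-cong (λ i → expand (x i) (y i) (z i)) ⟩
  sumℚ (λ i → s * (x i * y i) + t * (x i * z i))
    ≡⟨ sum-+ (λ i → s * (x i * y i)) (λ i → t * (x i * z i)) ⟩
  sumℚ (λ i → s * (x i * y i)) + sumℚ (λ i → t * (x i * z i))
    ≡⟨ cong₂ _+_ (sum-*ˡ s (λ i → x i * y i)) (sum-*ˡ t (λ i → x i * z i)) ⟩
  s * dot x y + t * dot x z ∎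
  where
  open ≡-Reasoning
  expand : ∀ a b c → a * (s * b + t * c) ≡ s * (a * b) + t * (a * c)
  expand a b c = solve (a ∷ b ∷ c ∷ s ∷ t ∷ []) ℚ-ring

dot-linˡ : ∀ {k} s (y : Fin k → ℚ) t (z x : Fin k → ℚ) →
  dot (λ i → s * y i + t * z i) x ≡ s * dot y x + t * dot z x
dot-linˡ s y t z x = trans (dot-comm (λ i → s * y i + t * z i) x)
  (trans (dot-linʳ x s y t z)
         (cong₂ (λ a b → s * a + t * b) (dot-comm x y) (dot-comm x z)))

dot-sumˡ : ∀ {j k} (w : Fin j → ℚ) (A : Fin j → Fin k → ℚ) (y : Fin k → ℚ) →
  dot (λ i → sumℚ (λ a → w a * A a i)) y ≡ dot w (λ a → dot (A a) y)
dot-sumˡ w A y = begin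
  sumℚ (λ i → sumℚ (λ a → w a * A a i) * y i)
    ≡⟨ sum-cong (λ i → trans (*-comm _ (y i)) (sym (sum-*ˡ (y i) (λ a → w a * A a i)))) ⟩
  sumℚ (λ i → sumℚ (λ a → y i * (w a * A a i)))
    ≡⟨ sum-swap (λ i a → y i * (w a * A a i)) ⟩
  sumℚ (λ a → sumℚ (λ i → y i * (w a * A a i)))
    ≡⟨ sum-cong (λ a → trans (sum-cong (λ i → shuffle (y i) (w a) (A a i)))
                             (sum-*ˡ (w a) (λ i → A a i * y i))) ⟩
  dot w (λ a → dot (A a) y) ∎
  where
  open ≡-Reasoning
  shuffle : ∀ p q r → p * (q * r) ≡ q * (r * p)
  shuffle = solve-∀ ℚ-ring

dot-monoʳ : ∀ {k} {x y z : Fin k → ℚ} → (∀ i → 0ℚ ≤ x i) → (∀ i → y i ≤ z i) →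
  dot x y ≤ dot x z
dot-monoʳ {x = x} x≥0 y≤z =
  sum-mono (λ i → *-monoˡ-≤-nonNeg (x i) ⦃ nonNegative (x≥0 i) ⦄ (y≤z i))

sum≡0⇒negative : ∀ {k} (f : Fin k → ℚ) → sumℚ f ≡ 0ℚ → ∀ i → f i ≢ 0ℚ → ∃[ j ] f j < 0ℚ
sum≡0⇒negative f Σf≡0 i fi≢0 with Fₚ.any? (λ j → f j <? 0ℚ)
... | yes neg = neg
... | no ¬neg = ⊥-elim (fi≢0 (≤-antisym (subst (f i ≤_) Σf≡0 (term≤sum f≥0 i)) (f≥0 i)))
  where
  f≥0 : ∀ j → 0ℚ ≤ f j
  f≥0 j = ≮⇒≥ (λ fj<0 → ¬neg (j , fj<0))

-- The Farkas lemma

Separates : ∀ {n N} → (Fin N → Point n) → Point n → Point n → Set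
Separates α γ x = (∀ i → dot (α i) x ≤ 0ℚ) × 0ℚ < dot γ x

ConicCombination : ∀ {n N} → (Fin N → Point n) → Point n → Point N → Set
ConicCombination α γ w = (∀ i → 0ℚ ≤ w i) × (∀ j → γ j ≡ sumℚ (λ i → w i * α i j))

0<square : ∀ p → p ≢ 0ℚ → 0ℚ < p * p
0<square p p≢0 = go (<-cmp p 0ℚ)
  where
  sq : ∀ q → - q * - q ≡ q * q
  sq = solve-∀ ℚ-ring
  go : Tri (p < 0ℚ) (p ≡ 0ℚ) (0ℚ < p) → 0ℚ < p * p
  go (tri≈ _ p≡0 _) = ⊥-elim (p≢0 p≡0)
  go (tri> _ _ 0<p) = 0<* 0<p 0<p
  go (tri< p<0 _ _) = subst (0ℚ <_) (sq p) (0<* (0<neg p<0) (0<neg p<0))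

-- Here x separates γ from every form but the first, on which it is positive, and r is the inverse
-- of that positive value. `project` subtracts from a form the multiple of `α zero` that makes it
-- vanish at x. It sends `α zero` itself to 0, so one form fewer remains.
module Projection {n N} (α : Fin (suc N) → Point n) (γ x : Point n) (r : ℚ)
  (αx≤0 : ∀ i → dot (α (suc i)) x ≤ 0ℚ) (0<γx : 0ℚ < dot γ x)
  (α₀x*r≡1 : dot (α zero) x * r ≡ 1ℚ) (0<r : 0ℚ < r) where

  open ≡-Reasoning

  project : Point n → Point n
  project β j = 1ℚ * β j + - (dot β x * r) * α zero j

  separation : ∀ x′ → Separates (λ i → project (α (suc i))) (project γ) x′ →
    ∃ (Separates α γ)
  separation x′ (αx′≤0 , 0<γx′) =
    x″ , αx″≤0 , subst (0ℚ <_) (sym (value γ)) 0<γx′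
    where
    x″ : Point n
    x″ j = 1ℚ * x′ j + - (dot (α zero) x′ * r) * x j
    -- The map from x′ to x″ is adjoint to `project`, so x″ inherits the signs that the projected
    -- forms have at x′, and the first form vanishes at x″.
    value : ∀ β → dot β x″ ≡ dot (project β) x′
    value β = begin
      dot β x″
        ≡⟨ dot-linʳ β 1ℚ x′ (- (dot (α zero) x′ * r)) x ⟩
      1ℚ * dot β x′ + - (dot (α zero) x′ * r) * dot β x
        ≡⟨ shuffle (dot β x′) (dot (α zero) x′) r (dot β x) ⟩
      1ℚ * dot β x′ + - (dot β x * r) * dot (α zero) x′
        ≡⟨ sym (dot-linˡ 1ℚ β (- (dot β x * r)) (α zero) x′) ⟩
      dot (project β) x′ ∎
      where
      shuffle : ∀ a b s c → 1ℚ * a + - (b * s) * c ≡ 1ℚ * a + - (c * s) * b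
      shuffle = solve-∀ ℚ-ring
    αx″≤0 : ∀ i → dot (α i) x″ ≤ 0ℚ
    αx″≤0 zero = ≤-reflexive (begin
      dot (α zero) x″
        ≡⟨ dot-linʳ (α zero) 1ℚ x′ (- (dot (α zero) x′ * r)) x ⟩
      1ℚ * dot (α zero) x′ + - (dot (α zero) x′ * r) * dot (α zero) x
        ≡⟨ shuffle (dot (α zero) x′) r (dot (α zero) x) ⟩
      dot (α zero) x′ * (1ℚ - dot (α zero) x * r)
        ≡⟨ cong (λ h → dot (α zero) x′ * (1ℚ - h)) α₀x*r≡1 ⟩
      dot (α zero) x′ * (1ℚ - 1ℚ)
        ≡⟨ *-zeroʳ (dot (α zero) x′) ⟩
      0ℚ ∎)
      where
      shuffle : ∀ a s b → 1ℚ * a + - (a * s) * b ≡ a * (1ℚ - b * s)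
      shuffle = solve-∀ ℚ-ring
    αx″≤0 (suc i) = subst (_≤ 0ℚ) (sym (value (α (suc i)))) (αx′≤0 i)

  combination : ∀ w → ConicCombination (λ i → project (α (suc i))) (project γ) w →
    ∃ (ConicCombination α γ)
  combination w (w≥0 , γ′≡) = w′ , w′≥0 , γ≡
    where
    βx : Point N
    βx i = dot (α (suc i)) x
    wβx≤0 : dot w βx ≤ 0ℚ
    wβx≤0 = subst (dot w βx ≤_)
      (trans (sum-cong {f = λ i → w i * 0ℚ} (λ i → *-zeroʳ (w i))) (sum-0 N)) (dot-monoʳ w≥0 αx≤0)
    -- The coefficient of `α zero` that undoes the projections. It is nonnegative because γ is
    -- positive at x while the forms after the first are nonpositive there.
    w₀ : ℚ
    w₀ = (dot γ x - dot w βx) * r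
    w′ : Point (suc N)
    w′ zero    = w₀
    w′ (suc i) = w i
    w′≥0 : ∀ i → 0ℚ ≤ w′ i
    w′≥0 zero    = 0≤* (0≤-diff (≤-trans wβx≤0 (<⇒≤ 0<γx))) (<⇒≤ 0<r)
    w′≥0 (suc i) = w≥0 i
    γ≡ : ∀ j → γ j ≡ w₀ * α zero j + sumℚ (λ i → w i * α (suc i) j)
    γ≡ j = begin
      γ j
        ≡⟨ unproject (γ j) (dot γ x) r (α zero j) ⟩
      project γ j + dot γ x * r * α zero j
        ≡⟨ cong (_+ dot γ x * r * α zero j) (trans (γ′≡ j) regroup) ⟩
      1ℚ * dot w βj + - (r * α zero j) * dot w βx + dot γ x * r * α zero j
        ≡⟨ collect (dot w βj) r (α zero j) (dot w βx) (dot γ x) ⟩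
      w₀ * α zero j + dot w βj ∎
      where
      βj : Point N
      βj i = α (suc i) j
      unproject : ∀ a g s b → a ≡ 1ℚ * a + - (g * s) * b + g * s * b
      unproject = solve-∀ ℚ-ring
      swap : ∀ v a d s b → v * (1ℚ * a + - (d * s) * b) ≡ v * (1ℚ * a + - (s * b) * d)
      swap = solve-∀ ℚ-ring
      collect : ∀ c s b d g → 1ℚ * c + - (s * b) * d + g * s * b ≡ (g - d) * s * b + c
      collect = solve-∀ ℚ-ring
      regroup : sumℚ (λ i → w i * project (α (suc i)) j) ≡ 1ℚ * dot w βj + - (r * α zero j) * dot w βx
      regroup = trans (sum-cong (λ i → swap (w i) (βj i) (βx i) r (α zero j)))
                      (dot-linʳ w 1ℚ βj (- (r * α zero j)) βx)

-- Bartl's proof of the Farkas lemma: if a point separating γ from the other forms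
-- violates the first form, project every form along that point and recurse.
farkas : ∀ {n} N (α : Fin N → Point n) (γ : Point n) →
  ∃ (Separates α γ) ⊎ ∃ (ConicCombination α γ)
farkas {n} zero α γ with Fₚ.any? (λ j → ¬? (γ j ≟ 0ℚ))
... | no all0 = inj₂ ((λ ()) , (λ ()) , λ j → decidable-stable (γ j ≟ 0ℚ) (λ γj≢0 → all0 (j , γj≢0)))
-- With no forms to respect, a nonzero γ separates itself.
... | yes (j , γj≢0) = inj₁ (γ , (λ ()) , <-≤-trans (0<square (γ j) γj≢0) (term≤sum γ²≥0 j))
  where
  γ²≥0 : ∀ i → 0ℚ ≤ γ i * γ i
  γ²≥0 i with γ i ≟ 0ℚ
  ... | yes γi≡0 = ≤-reflexive (sym (cong₂ _*_ γi≡0 γi≡0))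
  ... | no  γi≢0 = <⇒≤ (0<square (γ i) γi≢0)
farkas {n} (suc N) α γ with farkas N (λ i → α (suc i)) γ
... | inj₂ (w , w≥0 , γ≡) = inj₂ (w′ , w′≥0 , γ≡′)
  where
  w′ : Point (suc N)
  w′ zero    = 0ℚ
  w′ (suc i) = w i
  w′≥0 : ∀ i → 0ℚ ≤ w′ i
  w′≥0 zero    = ≤-refl
  w′≥0 (suc i) = w≥0 i
  γ≡′ : ∀ j → γ j ≡ 0ℚ * α zero j + sumℚ (λ i → w i * α (suc i) j)
  γ≡′ j = trans (γ≡ j) (sym (trans
    (cong (_+ sumℚ (λ i → w i * α (suc i) j)) (*-zeroˡ (α zero j)))
    (+-identityˡ (sumℚ (λ i → w i * α (suc i) j)))))
... | inj₁ (x , αx≤0 , 0<γx) with dot (α zero) x ≤? 0ℚ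
...   | yes α₀x≤0 = inj₁ (x , (λ { zero → α₀x≤0 ; (suc i) → αx≤0 i }) , 0<γx)
...   | no  α₀x≰0 with reciprocal-pos (dot (α zero) x) (≰⇒> α₀x≰0)
...     | r , α₀x*r≡1 , 0<r =
  [ (λ (x′ , sep) → inj₁ (separation x′ sep)) , (λ (w , comb) → inj₂ (combination w comb)) ]′
    (farkas N (λ i → project (α (suc i))) (project γ))
  where open Projection α γ x r αx≤0 0<γx α₀x*r≡1 0<r

-- The Farkas lemma with nonnegative unknowns

sum-↑ : ∀ m {n} (f : Point (m ℕ.+ n)) →
  sumℚ f ≡ sumℚ (λ i → f (i ↑ˡ n)) + sumℚ (λ j → f (m ↑ʳ j))
sum-↑ zero    f = sym (+-identityˡ (sumℚ f))
sum-↑ (suc m) f = trans (cong (f zero +_) (sum-↑ m (λ i → f (suc i))))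
  (sym (+-assoc (f zero) _ _))

infix 4 _==_

_==_ : ∀ {n} → Fin n → Fin n → Bool
i == j = ⌊ i F.≟ j ⌋

==-refl : ∀ {n} (i : Fin n) → (i == i) ≡ true
==-refl i with i F.≟ i
... | yes _  = refl
... | no i≢i = ⊥-elim (i≢i refl)

==⇒≡ : ∀ {n} {i j : Fin n} → (i == j) ≡ true → i ≡ j
==⇒≡ {i = i} {j} eq with i F.≟ j
... | yes i≡j = i≡j
... | no  _   = case eq of λ ()

≢⇒== : ∀ {n} {i j : Fin n} → i ≢ j → (i == j) ≡ false
≢⇒== {i = i} {j} i≢j with i F.≟ j
... | yes i≡j = ⊥-elim (i≢j i≡j)
... | no  _   = refl

𝟙 : Bool → ℚ
𝟙 b = if b then 1ℚ else 0ℚ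

unit : ∀ {n} → Fin n → Point n
unit i j = 𝟙 (i == j)

unit-self : ∀ {n} (i : Fin n) → unit i i ≡ 1ℚ
unit-self i = cong 𝟙 (==-refl i)

unit-other : ∀ {n} {i j : Fin n} → i ≢ j → unit i j ≡ 0ℚ
unit-other i≢j = cong 𝟙 (≢⇒== i≢j)

dot-single : ∀ {n} (x y : Point n) i → (∀ j → j ≢ i → x j ≡ 0ℚ) → dot x y ≡ x i * y i
dot-single x y i off = sum-single (λ j → x j * y j) i
  (λ j j≢i → trans (cong (_* y j) (off j j≢i)) (*-zeroˡ (y j)))

-- The negated unit vectors join the family of forms. A separating point then has nonnegative
-- coordinates, and in a conic combination the weights of these extra forms are the slack that turns
-- the equation for γ into an inequality.
farkas⁺ : ∀ {n N} (α : Fin N → Point n) (γ : Point n) →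
  (∃ λ x → (∀ j → 0ℚ ≤ x j) × Separates α γ x) ⊎
  (∃ λ w → (∀ i → 0ℚ ≤ w i) × (∀ j → γ j ≤ sumℚ (λ i → w i * α i j)))
farkas⁺ {n} {N} α γ with farkas (N ℕ.+ n) (α ++ (λ j l → - unit j l)) γ
... | inj₁ (x , αx≤0 , 0<γx) = inj₁ (x , x≥0 , α′x≤0 , 0<γx)
  where
  α′x≤0 : ∀ i → dot (α i) x ≤ 0ℚ
  α′x≤0 i = subst (λ β → dot β x ≤ 0ℚ) (lookup-++ˡ α (λ j l → - unit j l) i) (αx≤0 (i ↑ˡ n))
  x≥0 : ∀ j → 0ℚ ≤ x j
  x≥0 j = ≤-slack (- dot (λ l → - unit j l) x)
    (subst (_≤ - dot (λ l → - unit j l) x) refl (neg-antimono-≤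
      (subst (λ β → dot β x ≤ 0ℚ) (lookup-++ʳ α (λ i l → - unit i l) j) (αx≤0 (N ↑ʳ j)))))
    (begin
      x j                              ≡⟨ cancel (x j) ⟩
      0ℚ + - (- 1ℚ * x j)              ≡⟨ cong (λ u → 0ℚ + - (- u * x j)) (sym (unit-self j)) ⟩
      0ℚ + - (- unit j j * x j)        ≡⟨ cong (λ u → 0ℚ + - u) (sym (dot-single (λ l → - unit j l) x j off)) ⟩
      0ℚ + - dot (λ l → - unit j l) x  ∎)
    where
    open ≡-Reasoning
    cancel : ∀ a → a ≡ 0ℚ + - (- 1ℚ * a)
    cancel = solve-∀ ℚ-ring
    off : ∀ l → l ≢ j → - unit j l ≡ 0ℚ
    off l l≢j = cong -_ (unit-other (≢-sym l≢j))
... | inj₂ (w , w≥0 , γ≡) = inj₂ (w′ , (λ i → w≥0 (i ↑ˡ n)) , γ≤)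
  where
  w′ : Point N
  w′ i = w (i ↑ˡ n)
  γ≤ : ∀ j → γ j ≤ sumℚ (λ i → w′ i * α i j)
  γ≤ j = ≤-slack (w (N ↑ʳ j)) (w≥0 (N ↑ʳ j)) (begin
    S                                              ≡⟨ cancel S (w (N ↑ʳ j)) ⟩
    S + w (N ↑ʳ j) * - 1ℚ + w (N ↑ʳ j)             ≡⟨ cong (_+ w (N ↑ʳ j)) (sym split) ⟩
    γ j + w (N ↑ʳ j)                               ∎)
    where
    open ≡-Reasoning
    S : ℚ
    S = sumℚ (λ i → w′ i * α i j)
    α⁺ : Fin (N ℕ.+ n) → Point n
    α⁺ = α ++ (λ j l → - unit j l)
    cancel : ∀ a b → a ≡ a + b * - 1ℚ + b
    cancel = solve-∀ ℚ-ring
    slack : sumℚ (λ l → w (N ↑ʳ l) * α⁺ (N ↑ʳ l) j) ≡ w (N ↑ʳ j) * - 1ℚ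
    slack = trans (sum-single (λ l → w (N ↑ʳ l) * α⁺ (N ↑ʳ l) j) j off) (cong (w (N ↑ʳ j) *_)
        (trans (cong (λ β → β j) (lookup-++ʳ α (λ i l → - unit i l) j)) (cong -_ (unit-self j))))
      where
      off : ∀ l → l ≢ j → w (N ↑ʳ l) * α⁺ (N ↑ʳ l) j ≡ 0ℚ
      off l l≢j = trans (cong (w (N ↑ʳ l) *_) (trans (cong (λ β → β j) (lookup-++ʳ α (λ i l → - unit i l) l))
        (cong -_ (unit-other l≢j)))) (*-zeroʳ (w (N ↑ʳ l)))
    split : γ j ≡ S + w (N ↑ʳ j) * - 1ℚ
    split = trans (γ≡ j) (trans (sum-↑ N (λ i → w i * α⁺ i j)) (cong₂ _+_
      (sum-cong (λ i → cong (λ β → w′ i * β j) (lookup-++ˡ α (λ j l → - unit j l) i))) slack))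

-- The unknowns (y , λ , t) of the self-dual system below and its three groups of constraints both
-- have this shape, with the roles of p and q exchanged.
module Blocks {p q : ℕ} where

  1st : Fin p → Fin (p ℕ.+ (q ℕ.+ 1))
  1st i = i ↑ˡ (q ℕ.+ 1)

  2nd : Fin q → Fin (p ℕ.+ (q ℕ.+ 1))
  2nd j = p ↑ʳ (j ↑ˡ 1)

  3rd : Fin (p ℕ.+ (q ℕ.+ 1))
  3rd = p ↑ʳ (q ↑ʳ zero)

  module _ {A : Set} (f : Fin p → A) (g : Fin q → A) (h : A) where

    blocks : Fin (p ℕ.+ (q ℕ.+ 1)) → A
    blocks = f ++ (g ++ (λ _ → h))

    blocks-1st : ∀ i → blocks (1st i) ≡ f i
    blocks-1st i = lookup-++ˡ f (g ++ (λ (_ : Fin 1) → h)) i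

    blocks-2nd : ∀ j → blocks (2nd j) ≡ g j
    blocks-2nd j = trans (lookup-++ʳ f (g ++ (λ (_ : Fin 1) → h)) (j ↑ˡ 1))
                         (lookup-++ˡ g (λ (_ : Fin 1) → h) j)

    blocks-3rd : blocks 3rd ≡ h
    blocks-3rd = trans (lookup-++ʳ f (g ++ (λ (_ : Fin 1) → h)) (q ↑ʳ zero))
                       (lookup-++ʳ g (λ (_ : Fin 1) → h) zero)

  sum-blocks : ∀ (u : Point (p ℕ.+ (q ℕ.+ 1))) →
    sumℚ u ≡ sumℚ (λ i → u (1st i)) + (sumℚ (λ j → u (2nd j)) + u 3rd)
  sum-blocks u = trans (sum-↑ p u) (cong (sumℚ (λ i → u (1st i)) +_)
    (trans (sum-↑ q (λ l → u (p ↑ʳ l)))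
           (cong (sumℚ (λ j → u (2nd j)) +_) (+-identityʳ (u 3rd)))))

  dot-blocks : ∀ f g h (x : Point (p ℕ.+ (q ℕ.+ 1))) →
    dot (blocks f g h) x ≡ dot f (λ i → x (1st i)) + (dot g (λ j → x (2nd j)) + h * x 3rd)
  dot-blocks f g h x = trans (sum-blocks (λ l → blocks f g h l * x l)) (cong₂ _+_
    (sum-cong (λ i → cong (_* x (1st i)) (blocks-1st f g h i)))
    (cong₂ _+_ (sum-cong (λ j → cong (_* x (2nd j)) (blocks-2nd f g h j)))
               (cong (_* x 3rd) (blocks-3rd f g h))))

  combination-blocks : ∀ {n} (w : Point (p ℕ.+ (q ℕ.+ 1)))
    (f : Fin p → Point n) (g : Fin q → Point n) (h : Point n) (l : Fin n) →
    sumℚ (λ i → w i * blocks f g h i l) ≡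
    sumℚ (λ i → w (1st i) * f i l) + (sumℚ (λ j → w (2nd j) * g j l) + w 3rd * h l)
  combination-blocks w f g h l = trans (sum-blocks (λ i → w i * blocks f g h i l)) (cong₂ _+_
    (sum-cong (λ i → cong (λ z → w (1st i) * z l) (blocks-1st f g h i)))
    (cong₂ _+_ (sum-cong (λ j → cong (λ z → w (2nd j) * z l) (blocks-2nd f g h j)))
               (cong (λ z → w 3rd * z l) (blocks-3rd f g h))))

-- Strong duality for covering and packing

dot-0ˡ : ∀ {k} (y : Point k) → dot (λ _ → 0ℚ) y ≡ 0ℚ
dot-0ˡ {k} y = trans (sum-cong (λ i → *-zeroˡ (y i))) (sum-0 k)

dot-constˡ : ∀ {k} c (y : Point k) → dot (λ _ → c) y ≡ c * sumℚ y
dot-constˡ c y = sum-*ˡ c y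

dot-1ʳ : ∀ {k} (x : Point k) → dot x (λ _ → 1ℚ) ≡ sumℚ x
dot-1ʳ x = sum-cong (λ i → *-identityʳ (x i))

dot-scaleˡ : ∀ {k} c (x y : Point k) → dot (λ i → c * x i) y ≡ c * dot x y
dot-scaleˡ c x y = trans (sum-cong (λ i → *-assoc c (x i) (y i))) (sum-*ˡ c (λ i → x i * y i))

dot-scaleʳ : ∀ {k} c (x y : Point k) → dot x (λ i → c * y i) ≡ c * dot x y
dot-scaleʳ c x y = trans (dot-comm x (λ i → c * y i))
  (trans (dot-scaleˡ c y x) (cong (c *_) (dot-comm y x)))

dot-negˡ : ∀ {k} (x y : Point k) → dot (λ i → - x i) y ≡ - dot x y
dot-negˡ x y = begin
  dot (λ i → - x i) y         ≡⟨ sum-cong (λ i → flip (x i) (y i)) ⟩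
  sumℚ (λ i → - 1ℚ * (x i * y i)) ≡⟨ sum-*ˡ (- 1ℚ) (λ i → x i * y i) ⟩
  - 1ℚ * dot x y              ≡⟨ unflip (dot x y) ⟩
  - dot x y                   ∎
  where
  open ≡-Reasoning
  flip : ∀ a b → - a * b ≡ - 1ℚ * (a * b)
  flip = solve-∀ ℚ-ring
  unflip : ∀ a → - 1ℚ * a ≡ - a
  unflip = solve-∀ ℚ-ring

dot-negʳ : ∀ {k} (x y : Point k) → dot x (λ i → - y i) ≡ - dot x y
dot-negʳ x y = trans (dot-comm x (λ i → - y i)) (trans (dot-negˡ y x) (cong -_ (dot-comm y x)))

-- `A-big` makes the all-ones vector a feasible covering. This is what rules out a refutation of the
-- self-dual system in which the gap constraint has multiplier 0.
module StrongDuality {K m} (A : Fin K → Point m) (A-big : ∀ a → 1ℚ ≤ sumℚ (A a)) where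

  column : Point K → Point m
  column w e = sumℚ (λ a → w a * A a e)

  record Optimum : Set where
    field
      primal          : Point m
      dual            : Point K
      primal≥0        : ∀ e → 0ℚ ≤ primal e
      dual≥0          : ∀ a → 0ℚ ≤ dual a
      primal-feasible : ∀ a → 1ℚ ≤ dot (A a) primal
      dual-feasible   : ∀ e → column dual e ≤ 1ℚ
      no-gap          : sumℚ primal ≤ sumℚ dual

  -- μ, v and s are multipliers of the three groups of constraints. For positive s, bounding μ A v
  -- from both sides gives s Σμ ≤ s Σv, against the gap of 1. For s ≤ 0 the bound on μ A and `A-big`
  -- force Σμ ≤ 0, while the gap asks for at least 1.
  no-refutation : ∀ (μ : Point K) (v : Point m) (s : ℚ) →
    (∀ a → 0ℚ ≤ μ a) → (∀ e → 0ℚ ≤ v e) → 0ℚ ≤ s →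
    (∀ e → column μ e ≤ s) → (∀ a → s ≤ dot (A a) v) → 1ℚ + sumℚ v ≤ sumℚ μ → ⊥
  no-refutation μ v s μ≥0 v≥0 0≤s μA≤s s≤Av gap with s ≤? 0ℚ
  ... | no s≰0 = <-irrefl refl (<-≤-trans Σv<Σμ Σμ≤Σv)
    where
    Σv<Σμ : sumℚ v < sumℚ μ
    Σv<Σμ = <-≤-trans (<-slack 1ℚ 0<1 (+-comm 1ℚ (sumℚ v))) gap
    Σμ≤Σv : sumℚ μ ≤ sumℚ v
    Σμ≤Σv = *-cancelˡ-≤ s (≰⇒> s≰0) (begin
      s * sumℚ μ                    ≡⟨ sym (dot-constˡ s μ) ⟩
      dot (λ _ → s) μ               ≡⟨ dot-comm (λ _ → s) μ ⟩
      dot μ (λ _ → s)               ≤⟨ dot-monoʳ μ≥0 s≤Av ⟩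
      dot μ (λ a → dot (A a) v)     ≡⟨ sym (dot-sumˡ μ A v) ⟩
      dot (column μ) v              ≡⟨ dot-comm (column μ) v ⟩
      dot v (column μ)              ≤⟨ dot-monoʳ v≥0 μA≤s ⟩
      dot v (λ _ → s)               ≡⟨ dot-comm v (λ _ → s) ⟩
      dot (λ _ → s) v               ≡⟨ dot-constˡ s v ⟩
      s * sumℚ v                    ∎)
      where open ≤-Reasoning
  ... | yes s≤0 = <-irrefl refl (<-≤-trans 0<1 (≤-trans 1≤Σμ Σμ≤0))
    where
    1≤Σμ : 1ℚ ≤ sumℚ μ
    1≤Σμ = ≤-trans (≤-slack (sumℚ v) (sum-≥0 v≥0) refl) gap
    Σμ≤0 : sumℚ μ ≤ 0ℚ
    Σμ≤0 = begin
      sumℚ μ                                ≡⟨ sym (dot-1ʳ μ) ⟩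
      dot μ (λ _ → 1ℚ)                      ≤⟨ dot-monoʳ μ≥0 A-big ⟩
      dot μ (λ a → sumℚ (A a))              ≡⟨ dot-cong {x = μ} (λ _ → refl) (λ a → sym (dot-1ʳ (A a))) ⟩
      dot μ (λ a → dot (A a) (λ _ → 1ℚ))    ≡⟨ sym (dot-sumˡ μ A (λ _ → 1ℚ)) ⟩
      dot (column μ) (λ _ → 1ℚ)             ≡⟨ dot-1ʳ (column μ) ⟩
      sumℚ (column μ)                       ≤⟨ sum-mono (λ e → ≤-trans (μA≤s e) s≤0) ⟩
      sumℚ {m} (λ _ → 0ℚ)                   ≡⟨ sum-0 m ⟩
      0ℚ                                    ∎
      where open ≤-Reasoning

  -- The self-dual system in (y , λ , t):  t ≤ A y,  λ A ≤ t,  Σ y ≤ Σ λ,  0 < t.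

  private
    module Variables   = Blocks {m} {K}
    module Constraints = Blocks {K} {m}
    open Variables using (blocks; dot-blocks)
    vars : ℕ
    vars = m ℕ.+ (K ℕ.+ 1)

  row : Fin K → Point vars
  row a = blocks (λ e → - A a e) (λ _ → 0ℚ) 1ℚ

  col : Fin m → Point vars
  col e = blocks (λ _ → 0ℚ) (λ a → A a e) (- 1ℚ)

  gap : Point vars
  gap = blocks (λ _ → 1ℚ) (λ _ → - 1ℚ) 0ℚ

  scale : Point vars
  scale = blocks (λ _ → 0ℚ) (λ _ → 0ℚ) 1ℚ

  system : Fin (K ℕ.+ (m ℕ.+ 1)) → Point vars
  system = Constraints.blocks row col gap

  -- The system is homogeneous, so dividing by t, which the strict inequality makes positive,
  -- normalises the right-hand sides to 1.
  fromSolution : ∀ x → (∀ j → 0ℚ ≤ x j) → Separates system scale x → Optimum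
  fromSolution x x≥0 (sys≤0 , 0<scale) = record
    { primal          = λ e → r * y e
    ; dual            = λ a → r * l a
    ; primal≥0        = λ e → 0≤* (<⇒≤ 0<r) (x≥0 (Variables.1st e))
    ; dual≥0          = λ a → 0≤* (<⇒≤ 0<r) (x≥0 (Variables.2nd a))
    ; primal-feasible = λ a → subst₂ _≤_ rt≡1 (sym (dot-scaleʳ r (A a) y)) (r*-mono (t≤Ay a))
    ; dual-feasible   = λ e → subst₂ _≤_ (sym (trans (sum-cong (λ a → *-assoc r (l a) (A a e)))
                                                     (sum-*ˡ r (λ a → l a * A a e)))) rt≡1
                                (r*-mono (lA≤t e))
    ; no-gap          = subst₂ _≤_ (sym (sum-*ˡ r y)) (sym (sum-*ˡ r l)) (r*-mono Σy≤Σl)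
    }
    where
    y : Point m
    y e = x (Variables.1st e)
    l : Point K
    l a = x (Variables.2nd a)
    t : ℚ
    t = x Variables.3rd
    0<t : 0ℚ < t
    0<t = subst (0ℚ <_) (trans (dot-blocks (λ _ → 0ℚ) (λ _ → 0ℚ) 1ℚ x)
      (trans (cong₂ (λ a b → a + (b + 1ℚ * t)) (dot-0ˡ y) (dot-0ˡ l)) (tidy t))) 0<scale
      where
      tidy : ∀ c → 0ℚ + (0ℚ + 1ℚ * c) ≡ c
      tidy = solve-∀ ℚ-ring
    r = proj₁ (reciprocal-pos t 0<t)
    0<r : 0ℚ < r
    0<r = proj₂ (proj₂ (reciprocal-pos t 0<t))
    rt≡1 : r * t ≡ 1ℚ
    rt≡1 = trans (*-comm r t) (proj₁ (proj₂ (reciprocal-pos t 0<t)))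
    r*-mono : ∀ {p q} → p ≤ q → r * p ≤ r * q
    r*-mono = *-monoˡ-≤-nonNeg r ⦃ nonNegative (<⇒≤ 0<r) ⦄
    from-diff : ∀ {p q d} → d ≤ 0ℚ → d ≡ p - q → p ≤ q
    from-diff {p} {q} {d} d≤0 refl = ≤-slack (0ℚ - (p - q)) (0≤-diff d≤0) (cancel p q)
      where
      cancel : ∀ a b → b ≡ a + (0ℚ - (a - b))
      cancel = solve-∀ ℚ-ring
    t≤Ay : ∀ a → t ≤ dot (A a) y
    t≤Ay a = from-diff
      (subst (λ β → dot β x ≤ 0ℚ) (Constraints.blocks-1st row col gap a) (sys≤0 (Constraints.1st a)))
      (trans (dot-blocks (λ e → - A a e) (λ _ → 0ℚ) 1ℚ x)
        (trans (cong₂ (λ b c → b + (c + 1ℚ * t)) (dot-negˡ (A a) y) (dot-0ˡ l)) (tidy (dot (A a) y) t)))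
      where
      tidy : ∀ b c → - b + (0ℚ + 1ℚ * c) ≡ c - b
      tidy = solve-∀ ℚ-ring
    lA≤t : ∀ e → column l e ≤ t
    lA≤t e = from-diff
      (subst (λ β → dot β x ≤ 0ℚ) (Constraints.blocks-2nd row col gap e) (sys≤0 (Constraints.2nd e)))
      (trans (dot-blocks (λ _ → 0ℚ) (λ a → A a e) (- 1ℚ) x)
        (trans (cong₂ (λ b c → b + (c + - 1ℚ * t)) (dot-0ˡ y) (dot-comm (λ a → A a e) l))
               (tidy (column l e) t)))
      where
      tidy : ∀ b c → 0ℚ + (b + - 1ℚ * c) ≡ b - c
      tidy = solve-∀ ℚ-ring
    Σy≤Σl : sumℚ y ≤ sumℚ l
    Σy≤Σl = from-diff
      (subst (λ β → dot β x ≤ 0ℚ) (Constraints.blocks-3rd row col gap) (sys≤0 Constraints.3rd))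
      (trans (dot-blocks (λ _ → 1ℚ) (λ _ → - 1ℚ) 0ℚ x)
        (trans (cong₂ (λ b c → b + (c + 0ℚ * t)) (dot-constˡ 1ℚ y) (dot-constˡ (- 1ℚ) l))
               (tidy (sumℚ y) (sumℚ l) t)))
      where
      tidy : ∀ b c d → 1ℚ * b + (- 1ℚ * c + 0ℚ * d) ≡ b - c
      tidy = solve-∀ ℚ-ring

  -- Read in the coordinates y, λ and t in turn, the inequality for `scale` says μ A ≤ s, s ≤ A v
  -- and 1 + Σv ≤ Σμ, which is what `no-refutation` excludes.
  fromCombination : ∀ w → (∀ i → 0ℚ ≤ w i) →
    (∀ j → scale j ≤ sumℚ (λ i → w i * system i j)) → ⊥
  fromCombination w w≥0 scale≤ = no-refutation μ v s
    (λ a → w≥0 (Constraints.1st a)) (λ e → w≥0 (Constraints.2nd e)) (w≥0 Constraints.3rd)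
    μA≤s s≤Av gap≤
    where
    μ : Point K
    μ a = w (Constraints.1st a)
    v : Point m
    v e = w (Constraints.2nd e)
    s : ℚ
    s = w Constraints.3rd
    at : ∀ j → scale j ≤ sumℚ (λ a → μ a * row a j) + (sumℚ (λ e → v e * col e j) + s * gap j)
    at j = subst (scale j ≤_) (Constraints.combination-blocks w row col gap j) (scale≤ j)
    values : ∀ {c j α β δ} (f : Point K) (g : Point m) →
      scale j ≡ α → (∀ a → row a j ≡ f a) → (∀ e → col e j ≡ g e) → gap j ≡ c →
      dot μ f ≡ β → dot v g ≡ δ → α ≤ β + (δ + s * c)
    values {j = j} f g refl row≡ col≡ refl refl refl = subst (scale j ≤_)
      (cong₂ (λ p q → p + (q + s * gap j)) (dot-cong {x = μ} (λ _ → refl) row≡)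
                                           (dot-cong {x = v} (λ _ → refl) col≡)) (at j)
    dot-0ʳ : ∀ {k} (z : Point k) → dot z (λ _ → 0ℚ) ≡ 0ℚ
    dot-0ʳ z = trans (dot-comm z (λ _ → 0ℚ)) (dot-0ˡ z)
    μA≤s : ∀ e → column μ e ≤ s
    μA≤s e = ≤-slack (- column μ e + (0ℚ + s * 1ℚ))
      (values (λ a → - A a e) (λ _ → 0ℚ)
        (Variables.blocks-1st (λ _ → 0ℚ) (λ _ → 0ℚ) 1ℚ e)
        (λ a → Variables.blocks-1st (λ e → - A a e) (λ _ → 0ℚ) 1ℚ e)
        (λ e′ → Variables.blocks-1st (λ _ → 0ℚ) (λ a → A a e′) (- 1ℚ) e)
        (Variables.blocks-1st (λ _ → 1ℚ) (λ _ → - 1ℚ) 0ℚ e)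
        (dot-negʳ μ (λ a → A a e)) (dot-0ʳ v))
      (tidy (column μ e) s)
      where
      tidy : ∀ a b → b ≡ a + (- a + (0ℚ + b * 1ℚ))
      tidy = solve-∀ ℚ-ring
    s≤Av : ∀ a → s ≤ dot (A a) v
    s≤Av a = ≤-slack (0ℚ + (dot (A a) v + s * - 1ℚ))
      (values (λ _ → 0ℚ) (λ e → A a e)
        (Variables.blocks-2nd (λ _ → 0ℚ) (λ _ → 0ℚ) 1ℚ a)
        (λ a′ → Variables.blocks-2nd (λ e → - A a′ e) (λ _ → 0ℚ) 1ℚ a)
        (λ e → Variables.blocks-2nd (λ _ → 0ℚ) (λ a → A a e) (- 1ℚ) a)
        (Variables.blocks-2nd (λ _ → 1ℚ) (λ _ → - 1ℚ) 0ℚ a)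
        (dot-0ʳ μ) (dot-comm v (A a)))
      (tidy (dot (A a) v) s)
      where
      tidy : ∀ a b → a ≡ b + (0ℚ + (a + b * - 1ℚ))
      tidy = solve-∀ ℚ-ring
    gap≤ : 1ℚ + sumℚ v ≤ sumℚ μ
    gap≤ = ≤-slack (sumℚ μ + (- sumℚ v + s * 0ℚ) - 1ℚ)
      (0≤-diff (values (λ _ → 1ℚ) (λ _ → - 1ℚ)
        (Variables.blocks-3rd (λ _ → 0ℚ) (λ _ → 0ℚ) 1ℚ)
        (λ a → Variables.blocks-3rd (λ e → - A a e) (λ _ → 0ℚ) 1ℚ)
        (λ e → Variables.blocks-3rd (λ _ → 0ℚ) (λ a → A a e) (- 1ℚ))
        (Variables.blocks-3rd (λ _ → 1ℚ) (λ _ → - 1ℚ) 0ℚ)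
        (dot-1ʳ μ) (trans (dot-negʳ v (λ _ → 1ℚ)) (cong -_ (dot-1ʳ v)))))
      (tidy (sumℚ μ) (sumℚ v) s)
      where
      tidy : ∀ a b c → a ≡ 1ℚ + b + (a + (- b + c * 0ℚ) - 1ℚ)
      tidy = solve-∀ ℚ-ring

  optimum : Optimum
  optimum with farkas⁺ system scale
  ... | inj₁ (x , x≥0 , sep)    = fromSolution x x≥0 sep
  ... | inj₂ (w , w≥0 , scale≤) = ⊥-elim (fromCombination w w≥0 scale≤)

private
  module ℕ-+ = CommutativeSemigroupProperties ℕₚ.+-commutativeSemigroup
  module ⊕ = CommutativeSemigroupProperties
    (CommutativeRing.+-commutativeSemigroup xor-∧-commutativeRing)
-- Cardinalities and parity

sumℕ-cong : ∀ {k} {f g : Fin k → ℕ} → (∀ i → f i ≡ g i) → sumℕ f ≡ sumℕ g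
sumℕ-cong {zero}  eq = refl
sumℕ-cong {suc k} eq = cong₂ ℕ._+_ (eq zero) (sumℕ-cong (λ i → eq (suc i)))

sumℕ-mono : ∀ {k} {f g : Fin k → ℕ} → (∀ i → f i ℕ.≤ g i) → sumℕ f ℕ.≤ sumℕ g
sumℕ-mono {zero}  le = ℕ.z≤n
sumℕ-mono {suc k} le = ℕₚ.+-mono-≤ (le zero) (sumℕ-mono (λ i → le (suc i)))

sumℕ-+ : ∀ {k} (f g : Fin k → ℕ) → sumℕ (λ i → f i ℕ.+ g i) ≡ sumℕ f ℕ.+ sumℕ g
sumℕ-+ {zero}  f g = refl
sumℕ-+ {suc k} f g = trans (cong (f zero ℕ.+ g zero ℕ.+_) (sumℕ-+ (λ i → f (suc i)) (λ i → g (suc i))))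
  (ℕ-+.interchange (f zero) (g zero) _ _)

sumℕ-const : ∀ k c → sumℕ {k} (λ _ → c) ≡ k ℕ.* c
sumℕ-const zero    c = refl
sumℕ-const (suc k) c = cong (c ℕ.+_) (sumℕ-const k c)

sumℕ-swap : ∀ {j k} (f : Fin j → Fin k → ℕ) →
  sumℕ (λ a → sumℕ (f a)) ≡ sumℕ (λ b → sumℕ (λ a → f a b))
sumℕ-swap {zero}  {k} f = sym (trans (sumℕ-const k 0) (ℕₚ.*-zeroʳ k))
sumℕ-swap {suc j} {k} f = trans (cong (sumℕ (f zero) ℕ.+_) (sumℕ-swap (λ a → f (suc a))))
  (sym (sumℕ-+ (f zero) (λ b → sumℕ (λ a → f (suc a) b))))

[_]ℕ : Bool → ℕ
[ b ]ℕ = if b then 1 else 0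

card-cong : ∀ {k} {S T : Subset k} → (∀ i → S i ≡ T i) → card S ≡ card T
card-cong eq = sumℕ-cong (λ i → cong [_]ℕ (eq i))

card-mono : ∀ {k} {S T : Subset k} → (∀ i → S i ≡ true → T i ≡ true) → card S ℕ.≤ card T
card-mono {S = S} {T} S⊆T = sumℕ-mono le
  where
  le : ∀ i → [ S i ]ℕ ℕ.≤ [ T i ]ℕ
  le i with S i in eq
  ... | false = ℕ.z≤n
  ... | true rewrite S⊆T i eq = ℕₚ.≤-refl

card-split : ∀ {k} (S T : Subset k) →
  card S ≡ card (λ i → S i ∧ T i) ℕ.+ card (λ i → S i ∧ not (T i))
card-split S T = trans (sumℕ-cong (λ i → pointwise (S i) (T i)))
  (sumℕ-+ (λ i → [ S i ∧ T i ]ℕ) (λ i → [ S i ∧ not (T i) ]ℕ))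
  where
  pointwise : ∀ a b → [ a ]ℕ ≡ [ a ∧ b ]ℕ ℕ.+ [ a ∧ not b ]ℕ
  pointwise false b     = refl
  pointwise true  false = refl
  pointwise true  true  = refl

card-full : ∀ k → card {k} (λ _ → true) ≡ k
card-full k = trans (sumℕ-const k 1) (ℕₚ.*-identityʳ k)

card-complement : ∀ {k} (X : Subset k) → card X ℕ.+ card (λ v → not (X v)) ≡ k
card-complement {k} X = trans (sym (card-split (λ _ → true) X)) (card-full k)

card-empty : ∀ {k} {S : Subset k} → (∀ i → S i ≡ false) → card S ≡ 0
card-empty {k} empty = trans (card-cong empty) (trans (sumℕ-const k 0) (ℕₚ.*-zeroʳ k))

card≡0⇒empty : ∀ {k} {S : Subset k} → card S ≡ 0 → ∀ i → S i ≡ false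
card≡0⇒empty {suc k} {S} eq i with S zero in S0
card≡0⇒empty {suc k} {S} eq zero    | false = S0
card≡0⇒empty {suc k} {S} eq (suc i) | false = card≡0⇒empty {S = λ j → S (suc j)} eq i

card-singleton : ∀ {k} {S : Subset k} e → S e ≡ true → (∀ h → S h ≡ true → h ≡ e) → card S ≡ 1
card-singleton {suc k} {S} zero Se only rewrite Se = cong suc (card-empty empty)
  where
  empty : ∀ i → S (suc i) ≡ false
  empty i with S (suc i) in eq
  ... | false = refl
  ... | true  = case only (suc i) eq of λ ()
card-singleton {suc k} {S} (suc e) Se only with S zero in S0
... | true  = case only zero S0 of λ ()
... | false = card-singleton {S = λ i → S (suc i)} e Se
  (λ h Sh → Fₚ.suc-injective (only (suc h) Sh))

card≡1⇒singleton : ∀ {k} {S : Subset k} → card S ≡ 1 →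
  ∃[ e ] S e ≡ true × (∀ h → S h ≡ true → h ≡ e)
card≡1⇒singleton {suc k} {S} eq with S zero in S0
... | true = zero , S0 , only
  where
  only : ∀ h → S h ≡ true → h ≡ zero
  only zero    _  = refl
  only (suc h) Sh = case trans (sym Sh) (card≡0⇒empty {S = λ i → S (suc i)} (ℕₚ.suc-injective eq) h) of λ ()
... | false with card≡1⇒singleton {S = λ i → S (suc i)} eq
...   | e , Se , unique = suc e , Se , only
  where
  only : ∀ h → S h ≡ true → h ≡ suc e
  only zero    Sh = case trans (sym S0) Sh of λ ()
  only (suc h) Sh = cong suc (unique h Sh)

_without_ : ∀ {k} → Subset k → Fin k → Subset k
(S without x) i = S i ∧ not (x == i)

card-without : ∀ {k} (S : Subset k) x → S x ≡ true → card S ≡ suc (card (S without x))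
card-without S x Sx = trans (card-split S (x ==_)) (cong (ℕ._+ card (S without x))
  (card-singleton x (trans (cong (_∧ (x == x)) Sx) (==-refl x)) only))
  where
  only : ∀ h → S h ∧ (x == h) ≡ true → h ≡ x
  only h eq with S h
  ... | true = sym (==⇒≡ eq)

without-self : ∀ {k} (S : Subset k) x → (S without x) x ≡ false
without-self S x rewrite ==-refl x = ∧-zeroʳ (S x)

without-other : ∀ {k} (S : Subset k) {x i} → i ≢ x → (S without x) i ≡ S i
without-other S {x} {i} i≢x rewrite ≢⇒== (≢-sym i≢x) with S i
... | true  = refl
... | false = refl

nonempty : ∀ {k} (S : Subset k) → 0 ℕ.< card S → ∃[ e ] S e ≡ true
nonempty {suc k} S pos with S zero in S0
... | true  = zero , S0
... | false with nonempty (λ i → S (suc i)) pos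
...   | e , Se = suc e , Se

card≤2⇒pair : ∀ {k} (S : Subset k) e → S e ≡ true → card S ℕ.≤ 2 →
  ∃[ f ] ∀ h → S h ≡ true → h ≡ e ⊎ h ≡ f
card≤2⇒pair S e Se le with ℕₚ._≟_ (card (S without e)) 1
... | yes one with card≡1⇒singleton one
...   | f , _ , unique = f , λ h Sh → case h F.≟ e of λ where
        (yes h≡e) → inj₁ h≡e
        (no h≢e)  → inj₂ (unique h (trans (without-other S h≢e) Sh))
-- Here e is the only element, and it also serves as the second member of the pair.
card≤2⇒pair S e Se le | no ≢1 = e , λ h Sh → case h F.≟ e of λ where
        (yes h≡e) → inj₁ h≡e
        (no h≢e)  → case trans (sym (trans (without-other S h≢e) Sh)) (card≡0⇒empty rest≡0 h) of λ ()
  where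
  rest≤1 : card (S without e) ℕ.≤ 1
  rest≤1 = ℕₚ.≤-pred (subst (ℕ._≤ 2) (card-without S e Se) le)
  rest≡0 : card (S without e) ≡ 0
  rest≡0 = ℕₚ.n<1⇒n≡0 (ℕₚ.≤∧≢⇒< rest≤1 ≢1)

-- Parity takes values in `Bool` so that addition modulo 2 is `_xor_` and double counting modulo 2
-- is an exchange of two `⨁`.
par : ℕ → Bool
par zero    = false
par (suc n) = not (par n)

par-+ : ∀ a b → par (a ℕ.+ b) ≡ par a xor par b
par-+ zero    b = refl
par-+ (suc a) b = trans (cong not (par-+ a b)) (not-distribˡ-xor (par a) (par b))

Odd⇒par : ∀ n → Odd n → par n ≡ true
Odd⇒par (suc zero)    _ = refl
Odd⇒par (suc (suc n)) o rewrite Odd⇒par n o = refl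

par⇒Odd : ∀ n → par n ≡ true → Odd n
par⇒Odd (suc zero)    _ = refl
par⇒Odd (suc (suc n)) eq = par⇒Odd n (trans (sym (not-involutive (par n))) eq)

⨁ : ∀ {k} → (Fin k → Bool) → Bool
⨁ {zero}  f = false
⨁ {suc k} f = f zero xor ⨁ (λ i → f (suc i))

par-card : ∀ {k} (S : Subset k) → par (card S) ≡ ⨁ S
par-card {zero}  S = refl
par-card {suc k} S with S zero
... | true  = cong not (par-card (λ i → S (suc i)))
... | false = par-card (λ i → S (suc i))

⨁-cong : ∀ {k} {f g : Fin k → Bool} → (∀ i → f i ≡ g i) → ⨁ f ≡ ⨁ g
⨁-cong {zero}  eq = refl
⨁-cong {suc k} eq = cong₂ _xor_ (eq zero) (⨁-cong (λ i → eq (suc i)))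

⨁-false : ∀ k → ⨁ {k} (λ _ → false) ≡ false
⨁-false zero    = refl
⨁-false (suc k) = ⨁-false k

⨁-xor : ∀ {k} (f g : Fin k → Bool) → ⨁ (λ i → f i xor g i) ≡ ⨁ f xor ⨁ g
⨁-xor {zero}  f g = refl
⨁-xor {suc k} f g = trans (cong ((f zero xor g zero) xor_) (⨁-xor (λ i → f (suc i)) (λ i → g (suc i))))
  (⊕.interchange (f zero) (g zero) _ _)

⨁-∧ : ∀ {k} b (f : Fin k → Bool) → ⨁ (λ i → b ∧ f i) ≡ b ∧ ⨁ f
⨁-∧ {k} false f = ⨁-false k
⨁-∧     true  f = refl

⨁-swap : ∀ {j k} (f : Fin j → Fin k → Bool) →
  ⨁ (λ a → ⨁ (f a)) ≡ ⨁ (λ b → ⨁ (λ a → f a b))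
⨁-swap {zero}  {k} f = sym (⨁-false k)
⨁-swap {suc j} {k} f = trans (cong (⨁ (f zero) xor_) (⨁-swap (λ a → f (suc a))))
  (sym (⨁-xor (f zero) (λ b → ⨁ (λ a → f (suc a) b))))

⨁-single : ∀ {k} (f : Fin k → Bool) i → ⨁ (λ j → f j ∧ (j == i)) ≡ f i
⨁-single f i = trans (sym (par-card (λ j → f j ∧ (j == i)))) (value (f i) refl)
  where
  value : ∀ b → f i ≡ b → par (card (λ j → f j ∧ (j == i))) ≡ f i
  value true fi = trans (cong par (card-singleton i (trans (cong (_∧ (i == i)) fi) (==-refl i)) only)) (sym fi)
    where
    only : ∀ h → f h ∧ (h == i) ≡ true → h ≡ i
    only h eq with f h
    ... | true = ==⇒≡ eq
  value false fi = trans (cong par (card-empty empty)) (sym fi)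
    where
    empty : ∀ h → f h ∧ (h == i) ≡ false
    empty h with h F.≟ i
    ... | yes refl rewrite fi = refl
    ... | no  _    = ∧-zeroʳ (f h)

-- Exhaustive search

subsetAt : ∀ {m} → Fin (2 ℕ.^ m) → Subset m
subsetAt i e = F.finToFun i e == suc zero

indexOf : ∀ {m} → Subset m → Fin (2 ℕ.^ m)
indexOf X = F.funToFin (λ e → if X e then suc zero else zero)

-- Subsets are functions and are recovered from the enumeration only pointwise, so whatever is
-- searched for below has to respect pointwise equality.
subsetAt-indexOf : ∀ {m} (X : Subset m) e → subsetAt (indexOf X) e ≡ X e
subsetAt-indexOf X e = trans (cong (_== suc zero) (Fₚ.finToFun-funToFin (λ e → if X e then suc zero else zero) e)) (back (X e))
  where
  back : ∀ b → ((if b then suc zero else zero) == suc (zero {0})) ≡ b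
  back true  = refl
  back false = refl

minimise : ∀ {N} {P : Fin N → Set} (P? : ∀ i → Dec (P i)) (f : Point N) →
  (∃[ i ] P i × (∀ j → P j → f i ≤ f j)) ⊎ (∀ i → ¬ P i)
minimise {zero}  P? f = inj₂ λ ()
minimise {suc N} {P} P? f with minimise (λ i → P? (suc i)) (λ i → f (suc i)) | P? zero
... | inj₂ none | no ¬P0 = inj₂ λ { zero → ¬P0 ; (suc i) → none i }
... | inj₂ none | yes P0 = inj₁ (zero , P0 , λ { zero _ → ≤-refl ; (suc i) Pi → ⊥-elim (none i Pi) })
... | inj₁ (i , Pi , best) | no ¬P0 =
  inj₁ (suc i , Pi , λ { zero P0 → ⊥-elim (¬P0 P0) ; (suc j) Pj → best j Pj })
... | inj₁ (i , Pi , best) | yes P0 with ≤-total (f zero) (f (suc i))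
...   | inj₁ le = inj₁ (zero , P0 , λ { zero _ → ≤-refl ; (suc j) Pj → ≤-trans le (best j Pj) })
...   | inj₂ ge = inj₁ (suc i , Pi , λ { zero _ → ge ; (suc j) Pj → best j Pj })

-- The ratio test of the simplex method: ε is the least quotient of a value by its negated slope,
-- taken over the negative slopes. Up to this ε every value stays nonnegative, and the one attaining
-- the minimum reaches 0.
ratio-test : ∀ {N} {P : Fin N → Set} (P? : ∀ i → Dec (P i)) (a s : Point N) →
  (∀ i → P i → 0ℚ ≤ a i) →
  (∀ i → P i → 0ℚ ≤ s i) ⊎
  (∃[ ε ] 0ℚ ≤ ε × (∀ i → P i → 0ℚ ≤ a i + ε * s i) ×
          (∃[ i ] P i × s i < 0ℚ × a i + ε * s i ≡ 0ℚ))
ratio-test {N} {P} P? a s a≥0 with minimise {P = λ i → P i × s i < 0ℚ} (λ i → P? i ×-dec (s i <? 0ℚ)) (λ i → a i * inv (- s i))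
... | inj₂ none = inj₁ (λ i Pi → ≮⇒≥ (λ si<0 → none i (Pi , si<0)))
... | inj₁ (i , (Pi , si<0) , best) = inj₂ (ε , 0≤ε , bound , i , Pi , si<0 , tight)
  where
  ε : ℚ
  ε = a i * inv (- s i)
  0≤ε : 0ℚ ≤ ε
  0≤ε = 0≤* (a≥0 i Pi) (<⇒≤ (inv-pos (- s i) (0<neg si<0)))
  cancel : ∀ j → s j < 0ℚ → - s j * inv (- s j) ≡ 1ℚ
  cancel j sj<0 = *-inv (- s j) (≢-sym (<⇒≢ (0<neg sj<0)))
  factor : ∀ b t r → b + b * r * t ≡ b * (1ℚ - - t * r)
  factor = solve-∀ ℚ-ring
  tight : a i + ε * s i ≡ 0ℚ
  tight = trans (factor (a i) (s i) (inv (- s i)))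
    (trans (cong (λ u → a i * (1ℚ - u)) (cancel i si<0)) (*-zeroʳ (a i)))
  bound : ∀ j → P j → 0ℚ ≤ a j + ε * s j
  bound j Pj with s j <? 0ℚ
  ... | no  sj≮0 = 0≤+ (a≥0 j Pj) (0≤* 0≤ε (≮⇒≥ sj≮0))
  ... | yes sj<0 = subst (0ℚ ≤_) regroup
        (0≤* (0≤-diff (best j (Pj , sj<0))) (<⇒≤ (0<neg sj<0)))
    where
    expand : ∀ b r t e → (b * r - e) * - t ≡ b * (- t * r) + e * t
    expand = solve-∀ ℚ-ring
    regroup : (a j * inv (- s j) - ε) * - s j ≡ a j + ε * s j
    regroup = trans (expand (a j) (inv (- s j)) (s j) ε)
      (cong (_+ ε * s j) (trans (cong (a j *_) (cancel j sj<0)) (*-identityʳ (a j))))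

-- Gaussian elimination

module Elimination {k m} (rows : Fin (suc k) → Point m) (S : Subset m) (e : Fin m)
  (Se : S e ≡ true) (pivot≢0 : rows zero e ≢ 0ℚ) where

  r : ℚ
  r = inv (rows zero e)

  reduced : Fin k → Point m
  reduced i j = 1ℚ * rows (suc i) j + - (rows (suc i) e * r) * rows zero j

  -- The reduced rows have entry 0 in the pivot column, so changing d′ at e does not disturb them.
  -- The value at e is then free to be chosen so that the pivot row is annihilated as well.
  extend : ∀ d′ → (∀ j → (S without e) j ≡ false → d′ j ≡ 0ℚ) → (∃[ j ] d′ j ≢ 0ℚ) →
    (∀ i → dot (reduced i) d′ ≡ 0ℚ) →
    ∃[ d ] (∀ j → S j ≡ false → d j ≡ 0ℚ) × (∃[ j ] d j ≢ 0ℚ) × (∀ i → dot (rows i) d ≡ 0ℚ)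
  extend d′ supported (j₀ , d′j₀≢0) annihilated = d , d-supported , (j₀ , dj₀≢0) , d-annihilated
    where
    open ≡-Reasoning
    D : ℚ
    D = dot (rows zero) d′
    d : Point m
    d j = 1ℚ * d′ j + - (D * r) * unit e j
    d-other : ∀ j → j ≢ e → d j ≡ d′ j
    d-other j j≢e = trans (cong (λ u → 1ℚ * d′ j + - (D * r) * u) (unit-other (≢-sym j≢e)))
      (tidy (d′ j) (- (D * r)))
      where
      tidy : ∀ a b → 1ℚ * a + b * 0ℚ ≡ a
      tidy = solve-∀ ℚ-ring
    d-supported : ∀ j → S j ≡ false → d j ≡ 0ℚ
    d-supported j Sj with j F.≟ e
    ... | yes refl = case trans (sym Se) Sj of λ ()
    ... | no  j≢e  = trans (d-other j j≢e) (supported j (trans (without-other S j≢e) Sj))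
    dj₀≢0 : d j₀ ≢ 0ℚ
    dj₀≢0 with j₀ F.≟ e
    ... | yes refl = ⊥-elim (d′j₀≢0 (supported e (without-self S e)))
    ... | no  j≢e  = λ dj₀≡0 → d′j₀≢0 (trans (sym (d-other j₀ j≢e)) dj₀≡0)
    dot-d : ∀ x → dot x d ≡ 1ℚ * dot x d′ + - (D * r) * x e
    dot-d x = trans (dot-linʳ x 1ℚ d′ (- (D * r)) (unit e))
      (cong (λ u → 1ℚ * dot x d′ + - (D * r) * u) (begin
        dot x (unit e)     ≡⟨ dot-comm x (unit e) ⟩
        dot (unit e) x     ≡⟨ dot-single (unit e) x e (λ j j≢e → unit-other (≢-sym j≢e)) ⟩
        unit e e * x e     ≡⟨ cong (_* x e) (unit-self e) ⟩
        1ℚ * x e           ≡⟨ *-identityˡ (x e) ⟩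
        x e                ∎))
    d-annihilated : ∀ i → dot (rows i) d ≡ 0ℚ
    d-annihilated zero = trans (dot-d (rows zero)) (trans (factor D r (rows zero e))
      (trans (cong (λ u → D * (1ℚ - u)) (*-inv (rows zero e) pivot≢0)) (*-zeroʳ D)))
      where
      factor : ∀ a b c → 1ℚ * a + - (a * b) * c ≡ a * (1ℚ - c * b)
      factor = solve-∀ ℚ-ring
    d-annihilated (suc i) = trans (dot-d (rows (suc i)))
      (trans (commute (dot (rows (suc i)) d′) D r (rows (suc i) e))
        (trans (sym (dot-linˡ 1ℚ (rows (suc i)) (- (rows (suc i) e * r)) (rows zero) d′)) (annihilated i)))
      where
      commute : ∀ a b c f → 1ℚ * a + - (b * c) * f ≡ 1ℚ * a + - (f * c) * b
      commute = solve-∀ ℚ-ring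

-- Fewer equations than unknowns. A pivot uses up one row and one element of S, and a row that
-- vanishes on S is dropped, so the strict inequality survives until no row is left.
kernel : ∀ {m} k (rows : Fin k → Point m) (S : Subset m) → k ℕ.< card S →
  ∃[ d ] (∀ e → S e ≡ false → d e ≡ 0ℚ) × (∃[ e ] d e ≢ 0ℚ) × (∀ i → dot (rows i) d ≡ 0ℚ)
kernel zero rows S 0<S with nonempty S 0<S
... | e , Se = unit e , supported , (e , λ eq → 1≢0 (trans (sym (unit-self e)) eq)) , λ ()
  where
  supported : ∀ j → S j ≡ false → unit e j ≡ 0ℚ
  supported j Sj = unit-other λ { refl → case trans (sym Se) Sj of λ () }
kernel (suc k) rows S k<S with Fₚ.any? (λ e → (S e Boolₚ.≟ true) ×-dec ¬? (rows zero e ≟ 0ℚ))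
... | yes (e , Se , pivot≢0) with kernel k reduced (S without e)
                                  (ℕₚ.≤-pred (subst (suc k ℕ.<_) (card-without S e Se) k<S))
  where open Elimination rows S e Se pivot≢0
...   | d′ , supported , nonzero , annihilated = extend d′ supported nonzero annihilated
  where open Elimination rows S e Se pivot≢0
kernel {m} (suc k) rows S k<S | no none with kernel k (λ i → rows (suc i)) S (ℕₚ.<-trans (ℕₚ.n<1+n k) k<S)
... | d , supported , nonzero , annihilated = d , supported , nonzero , all-annihilated
  where
  all-annihilated : ∀ i → dot (rows i) d ≡ 0ℚ
  all-annihilated (suc i) = annihilated i
  all-annihilated zero    = trans (sum-cong vanish) (sum-0 m)
    where
    vanish : ∀ e → rows zero e * d e ≡ 0ℚ
    vanish e with S e in Se
    ... | false = trans (cong (rows zero e *_) (supported e Se)) (*-zeroʳ (rows zero e))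
    ... | true  = trans (cong (_* d e) (decidable-stable (rows zero e ≟ 0ℚ) (λ ≢0 → none (e , Se , ≢0))))
                        (*-zeroˡ (d e))

-- Contraction creates loops and parallel edges; a loop lies in no cut δ G X.
Multigraph : ℕ → ℕ → Set
Multigraph k m = Fin m → Fin k × Fin k

-- Cuts and perfect matchings of multigraphs

δ : ∀ {k m} → Multigraph k m → Subset k → Subset m
δ G X e = X (proj₁ (G e)) xor X (proj₂ (G e))

δ-cong : ∀ {k m} (G : Multigraph k m) {X Y : Subset k} → (∀ v → X v ≡ Y v) → ∀ e → δ G X e ≡ δ G Y e
δ-cong G eq e = cong₂ _xor_ (eq (proj₁ (G e))) (eq (proj₂ (G e)))

δ-complement : ∀ {k m} (G : Multigraph k m) (X : Subset k) e → δ G (λ v → not (X v)) e ≡ δ G X e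
δ-complement G X e = Boolₚ.xor-annihilates-not (X (proj₁ (G e))) (X (proj₂ (G e)))

χ : ∀ {m} → Subset m → Point m
χ S e = 𝟙 (S e)

weight : ∀ {k m} → Multigraph k m → Point m → Subset k → ℚ
weight G b X = dot (χ (δ G X)) b

weight-cong : ∀ {k m} (G : Multigraph k m) b {X Y : Subset k} → (∀ v → X v ≡ Y v) →
  weight G b X ≡ weight G b Y
weight-cong G b eq = dot-cong {y = b} (λ e → cong 𝟙 (δ-cong G eq e)) (λ _ → refl)

weight-complement : ∀ {k m} (G : Multigraph k m) b (X : Subset k) →
  weight G b (λ v → not (X v)) ≡ weight G b X
weight-complement G b X = dot-cong {y = b} (λ e → cong 𝟙 (δ-complement G X e)) (λ _ → refl)

-- The star of v is expressed as the cut of the set of v alone, so that a loop never covers its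
-- vertex and stars are handled by the same lemmas as cuts.
Perfect : ∀ {k m} → Multigraph k m → Subset m → Set
Perfect G M = ∀ v → card (λ e → M e ∧ δ G (v ==_) e) ≡ 1

perfect? : ∀ {k m} (G : Multigraph k m) M → Dec (Perfect G M)
perfect? G M = Fₚ.all? (λ v → card (λ e → M e ∧ δ G (v ==_) e) ℕₚ.≟ 1)

perfect-cong : ∀ {k m} (G : Multigraph k m) {M N : Subset m} → (∀ e → M e ≡ N e) → Perfect G M → Perfect G N
perfect-cong G eq pm v = trans (card-cong (λ e → cong (_∧ δ G (v ==_) e) (sym (eq e)))) (pm v)

-- Modulo 2 the cut of X is the sum of the stars of the vertices of X, since an edge inside X is
-- counted twice, and a perfect matching meets each star once.
perfect-parity : ∀ {k m} (G : Multigraph k m) {M} → Perfect G M → ∀ X →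
  par (card (λ e → M e ∧ δ G X e)) ≡ par (card X)
perfect-parity G {M} pm X = begin
  par (card (λ e → M e ∧ δ G X e))
    ≡⟨ par-card (λ e → M e ∧ δ G X e) ⟩
  ⨁ (λ e → M e ∧ δ G X e)
    ≡⟨ ⨁-cong (λ e → cong (M e ∧_) (sym (ends-sum e))) ⟩
  ⨁ (λ e → M e ∧ ⨁ (λ v → X v ∧ δ G (v ==_) e))
    ≡⟨ ⨁-cong (λ e → trans (sym (⨁-∧ (M e) (λ v → X v ∧ δ G (v ==_) e)))
                           (⨁-cong (λ v → swap (M e) (X v) (δ G (v ==_) e)))) ⟩
  ⨁ (λ e → ⨁ (λ v → X v ∧ (M e ∧ δ G (v ==_) e)))
    ≡⟨ ⨁-swap (λ e v → X v ∧ (M e ∧ δ G (v ==_) e)) ⟩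
  ⨁ (λ v → ⨁ (λ e → X v ∧ (M e ∧ δ G (v ==_) e)))
    ≡⟨ ⨁-cong (λ v → trans (⨁-∧ (X v) (λ e → M e ∧ δ G (v ==_) e))
         (trans (cong (X v ∧_) (trans (sym (par-card (λ e → M e ∧ δ G (v ==_) e))) (cong par (pm v))))
                (∧-identityʳ (X v)))) ⟩
  ⨁ X
    ≡⟨ sym (par-card X) ⟩
  par (card X) ∎
  where
  open ≡-Reasoning
  swap : ∀ a b c → a ∧ (b ∧ c) ≡ b ∧ (a ∧ c)
  swap false b c = sym (∧-zeroʳ b)
  swap true  b c = refl
  ends-sum : ∀ e → ⨁ (λ v → X v ∧ δ G (v ==_) e) ≡ δ G X e
  ends-sum e = trans (⨁-cong (λ v → ∧-distribˡ-xor (X v) (v == proj₁ (G e)) (v == proj₂ (G e))))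
    (trans (⨁-xor (λ v → X v ∧ (v == proj₁ (G e))) (λ v → X v ∧ (v == proj₂ (G e))))
           (cong₂ _xor_ (⨁-single X (proj₁ (G e))) (⨁-single X (proj₂ (G e)))))

odd-complement : ∀ {k} (X : Subset k) → par k ≡ false → par (card X) ≡ true →
  par (card (λ v → not (X v))) ≡ true
odd-complement {k} X even odd = xor-true (par (card (λ v → not (X v)))) (begin
  true xor par (card (λ v → not (X v)))           ≡⟨ cong (_xor par (card (λ v → not (X v)))) (sym odd) ⟩
  par (card X) xor par (card (λ v → not (X v)))   ≡⟨ sym (par-+ (card X) (card (λ v → not (X v)))) ⟩
  par (card X ℕ.+ card (λ v → not (X v)))         ≡⟨ cong par (card-complement X) ⟩
  par k                                           ≡⟨ even ⟩
  false                                           ∎)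
  where
  open ≡-Reasoning
  xor-true : ∀ a → true xor a ≡ false → a ≡ true
  xor-true true _ = refl

-- Loops lie in no cut, so only `noloop` controls b on them. `oddcut` ranges over all odd sets,
-- singletons included, so that preimages under a contraction call for no case distinction.
record Feasible {k m} (G : Multigraph k m) (b : Point m) : Set where
  field
    nonneg : ∀ e → 0ℚ ≤ b e
    noloop : ∀ e → proj₁ (G e) ≡ proj₂ (G e) → b e ≡ 0ℚ
    degree : ∀ v → weight G b (v ==_) ≡ 1ℚ
    oddcut : ∀ X → par (card X) ≡ true → 1ℚ ≤ weight G b X

-- Contracting the complement of X to the vertex 0

record Contracts {k c} (X : Subset k) (f : Fin k → Fin (suc c)) : Set where
  field
    outside   : ∀ v → X v ≡ false → f v ≡ zero
    inside    : ∀ v → X v ≡ true → f v ≢ zero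
    injective : ∀ v w → X v ≡ true → f v ≡ f w → v ≡ w
    onto      : ∀ i → ∃[ v ] X v ≡ true × f v ≡ suc i
    -- The preimage of Y, counted modulo 2: vertex 0 counts once for each vertex missing from X, any
    -- other vertex once. If X misses an odd number of vertices, preimages therefore keep their
    -- parity.
    parity    : ∀ (Y : Subset (suc c)) → ⨁ (λ v → Y (f v)) ≡ (Y zero ∧ ⨁ (λ v → not (X v))) xor ⨁ (λ i → Y (suc i))

-- Frees the name 1 for a new vertex of X while the contracted vertex stays 0.
bump : ∀ {c} → Fin (suc c) → Fin (suc (suc c))
bump zero    = zero
bump (suc i) = suc (suc i)

shrinkStep : ∀ b {k c} → (Fin k → Fin (suc c)) → Fin (suc k) → Fin (suc ([ b ]ℕ ℕ.+ c))
shrinkStep true  f zero    = suc zero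
shrinkStep true  f (suc v) = bump (f v)
shrinkStep false f zero    = zero
shrinkStep false f (suc v) = f v

bump-zero : ∀ {c} {i : Fin (suc c)} → bump i ≡ zero → i ≡ zero
bump-zero {i = zero} _ = refl

bump-injective : ∀ {c} {i j : Fin (suc c)} → bump i ≡ bump j → i ≡ j
bump-injective {i = zero}  {zero}  _    = refl
bump-injective {i = suc i} {suc j} refl = refl

bump≢1 : ∀ {c} {i : Fin (suc c)} → bump i ≢ suc zero
bump≢1 {i = zero}  ()
bump≢1 {i = suc i} ()

contracts-step : ∀ {k c} (X : Subset (suc k)) {f : Fin k → Fin (suc c)} →
  Contracts (λ v → X (suc v)) f → Contracts X (shrinkStep (X zero) f)
contracts-step {k} {c} X {f} C with X zero in X0
... | true = record
  { outside   = λ { zero X0′ → case trans (sym X0) X0′ of λ () ; (suc v) Xv → cong bump (outside v Xv) }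
  ; inside    = λ { zero _ () ; (suc v) Xv eq → inside v Xv (bump-zero eq) }
  ; injective = inj
  ; onto      = λ { zero → zero , X0 , refl
                  ; (suc i) → let v , Xv , fv = onto i in suc v , Xv , cong bump fv }
  ; parity    = par′
  }
  where
  open Contracts C
  inj : ∀ v w → X v ≡ true → shrinkStep true f v ≡ shrinkStep true f w → v ≡ w
  inj zero    zero    _  _  = refl
  inj zero    (suc w) _  eq = ⊥-elim (bump≢1 (sym eq))
  inj (suc v) zero    _  eq = ⊥-elim (bump≢1 eq)
  inj (suc v) (suc w) Xv eq = cong suc (injective v w Xv (bump-injective eq))
  par′ : ∀ (Y : Subset (suc (suc c))) → Y (suc zero) xor ⨁ (λ v → Y (bump (f v))) ≡
    (Y zero ∧ (not (X zero) xor ⨁ (λ v → not (X (suc v))))) xor (Y (suc zero) xor ⨁ (λ i → Y (suc (suc i))))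
  par′ Y = trans (cong (Y (suc zero) xor_) (parity (λ i → Y (bump i))))
    (trans (⊕.x∙yz≈y∙xz (Y (suc zero)) (Y zero ∧ P) Q)
           (cong (λ a → (Y zero ∧ (not a xor P)) xor (Y (suc zero) xor Q)) (sym X0)))
    where
    P = ⨁ (λ v → not (X (suc v)))
    Q = ⨁ (λ i → Y (suc (suc i)))
... | false = record
  { outside   = λ { zero _ → refl ; (suc v) Xv → outside v Xv }
  ; inside    = λ { zero X0′ _ → case trans (sym X0) X0′ of λ () ; (suc v) Xv → inside v Xv }
  ; injective = inj
  ; onto      = λ i → let v , Xv , fv = onto i in suc v , Xv , fv
  ; parity    = par′
  }
  where
  open Contracts C
  inj : ∀ v w → X v ≡ true → shrinkStep false f v ≡ shrinkStep false f w → v ≡ w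
  inj zero    w       Xv _  = case trans (sym X0) Xv of λ ()
  inj (suc v) zero    Xv eq = ⊥-elim (inside v Xv eq)
  inj (suc v) (suc w) Xv eq = cong suc (injective v w Xv eq)
  par′ : ∀ (Y : Subset (suc c)) → Y zero xor ⨁ (λ v → Y (f v)) ≡
    (Y zero ∧ (not (X zero) xor ⨁ (λ v → not (X (suc v))))) xor ⨁ (λ i → Y (suc i))
  par′ Y = trans (cong (Y zero xor_) (parity Y))
    (trans (absorb (Y zero) P Q) (cong (λ a → (Y zero ∧ (not a xor P)) xor Q) (sym X0)))
    where
    P = ⨁ (λ v → not (X (suc v)))
    Q = ⨁ (λ i → Y (suc i))
    absorb : ∀ y p q → y xor ((y ∧ p) xor q) ≡ (y ∧ not p) xor q
    absorb false p q = refl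
    absorb true  p q = not-distribˡ-xor p q

shrink : ∀ {k} (X : Subset k) → Fin k → Fin (suc (card X))
shrink {suc k} X = shrinkStep (X zero) (shrink (λ v → X (suc v)))

shrink-contracts : ∀ {k} (X : Subset k) → Contracts X (shrink X)
shrink-contracts {zero} X = record
  { outside = λ () ; inside = λ () ; injective = λ () ; onto = λ ()
  ; parity = λ Y → sym (trans (xor-identityʳ (Y zero ∧ false)) (∧-zeroʳ (Y zero))) }
shrink-contracts {suc k} X = contracts-step X (shrink-contracts (λ v → X (suc v)))

module Contraction {k m} (G : Multigraph k m) (X : Subset k) where

  open Contracts (shrink-contracts X)

  f : Fin k → Fin (suc (card X))
  f = shrink X

  G/ : Multigraph (suc (card X)) m
  G/ e = f (proj₁ (G e)) , f (proj₂ (G e))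

  touches : Subset m
  touches e = X (proj₁ (G e)) ∨ X (proj₂ (G e))

  -- Edges without an end in X become loops at 0. Clearing their value is what `noloop` demands of
  -- the contracted graph.
  restrict : Point m → Point m
  restrict b e = if touches e then b e else 0ℚ

  preimage-zero : ∀ v → (zero == f v) ≡ not (X v)
  preimage-zero v with X v in Xv
  ... | true  = ≢⇒== (λ eq → inside v Xv (sym eq))
  ... | false rewrite outside v Xv = ==-refl {suc (card X)} zero

  preimage-suc : ∀ {u i} → X u ≡ true → f u ≡ suc i → ∀ v → (suc i == f v) ≡ (u == v)
  preimage-suc {u} {i} Xu fu v with u F.≟ v
  ... | yes refl = trans (cong (_== f u) (sym fu)) (==-refl (f u))
  ... | no  u≢v  = ≢⇒== (λ eq → u≢v (injective u v Xu (trans fu eq)))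

  weight-restrict : ∀ b Y → weight G/ (restrict b) Y ≡ weight G b (λ v → Y (f v))
  weight-restrict b Y = sum-cong pointwise
    where
    pointwise : ∀ e → χ (δ G/ Y) e * restrict b e ≡ χ (δ G (λ v → Y (f v))) e * b e
    pointwise e with X (proj₁ (G e)) in Xp | X (proj₂ (G e)) in Xq
    ... | true  | _    = refl
    ... | false | true = refl
    ... | false | false rewrite outside _ Xp | outside _ Xq | xor-same (Y zero) =
      sym (*-zeroˡ (b e))

  -- Tightness of X is the degree condition at the contracted vertex. Odd sets pull back to odd sets
  -- because the contracted complement of X is odd, and cut weights agree with those of the
  -- preimages.
  feasible/ : ∀ {b} → Feasible G b → par k ≡ false → par (card X) ≡ true →
    weight G b X ≡ 1ℚ → Feasible G/ (restrict b)
  feasible/ {b} feas even odd tight = record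
    { nonneg = nonneg/ ; noloop = noloop/ ; degree = degree/ ; oddcut = oddcut/ }
    where
    open Feasible feas
    nonneg/ : ∀ e → 0ℚ ≤ restrict b e
    nonneg/ e with touches e
    ... | true  = nonneg e
    ... | false = ≤-refl
    noloop/ : ∀ e → f (proj₁ (G e)) ≡ f (proj₂ (G e)) → restrict b e ≡ 0ℚ
    noloop/ e eq with X (proj₁ (G e)) in Xp | X (proj₂ (G e)) in Xq
    ... | true  | _     = noloop e (injective _ _ Xp eq)
    ... | false | true  = noloop e (sym (injective _ _ Xq (sym eq)))
    ... | false | false = refl
    degree/ : ∀ v → weight G/ (restrict b) (v ==_) ≡ 1ℚ
    degree/ zero = trans (weight-restrict b (zero ==_))
      (trans (weight-cong G b preimage-zero) (trans (weight-complement G b X) tight))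
    degree/ (suc i) with onto i
    ... | u , Xu , fu = trans (weight-restrict b (suc i ==_))
      (trans (weight-cong G b (preimage-suc Xu fu)) (degree u))
    oddcut/ : ∀ Y → par (card Y) ≡ true → 1ℚ ≤ weight G/ (restrict b) Y
    oddcut/ Y oddY = subst (1ℚ ≤_) (sym (weight-restrict b Y)) (oddcut (λ v → Y (f v)) odd-preimage)
      where
      odd-preimage : par (card (λ v → Y (f v))) ≡ true
      odd-preimage = begin
        par (card (λ v → Y (f v)))                                       ≡⟨ par-card (λ v → Y (f v)) ⟩
        ⨁ (λ v → Y (f v))                                                ≡⟨ parity Y ⟩
        (Y zero ∧ ⨁ (λ v → not (X v))) xor ⨁ (λ i → Y (suc i))
          ≡⟨ cong (λ a → (Y zero ∧ a) xor ⨁ (λ i → Y (suc i)))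
               (trans (sym (par-card (λ v → not (X v)))) (odd-complement X even odd)) ⟩
        (Y zero ∧ true) xor ⨁ (λ i → Y (suc i))
          ≡⟨ cong (_xor ⨁ (λ i → Y (suc i))) (∧-identityʳ (Y zero)) ⟩
        ⨁ Y                                                              ≡⟨ sym (par-card Y) ⟩
        par (card Y)                                                     ≡⟨ oddY ⟩
        true                                                             ∎
        where open ≡-Reasoning

  perfect-inside : ∀ {M} → Perfect G/ M → ∀ u → X u ≡ true → card (λ e → M e ∧ δ G (u ==_) e) ≡ 1
  perfect-inside {M} pm u Xu with f u in fu
  ... | zero  = ⊥-elim (inside u Xu fu)
  ... | suc i = trans (card-cong (λ e → cong (M e ∧_) (sym (δ-cong G (preimage-suc Xu fu) e)))) (pm (suc i))

  perfect-cut : ∀ {M} → Perfect G/ M → card (λ e → M e ∧ δ G X e) ≡ 1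
  perfect-cut {M} pm = trans (card-cong (λ e → cong (M e ∧_)
    (trans (sym (δ-complement G X e)) (sym (δ-cong G preimage-zero e))))) (pm zero)

-- Cheap matchings inside the support

Supported : ∀ {k m} → Multigraph k m → Point m → Subset m → Set
Supported G b M = Perfect G M × (∀ e → M e ≡ true → 0ℚ < b e)

supported? : ∀ {k m} (G : Multigraph k m) b M → Dec (Supported G b M)
supported? G b M = perfect? G M ×-dec Fₚ.all? (λ e → (M e Boolₚ.≟ true) →-dec (0ℚ <? b e))

supported-cong : ∀ {k m} (G : Multigraph k m) b {M N : Subset m} → (∀ e → M e ≡ N e) →
  Supported G b M → Supported G b N
supported-cong G b eq (pm , pos) = perfect-cong G eq pm , λ e Ne → pos e (trans (eq e) Ne)

-- By linear duality this amounts to b being a convex combination of perfect matchings, but no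
-- coefficients have to be split or matched up when two sides of a cut are glued. Keeping M inside
-- the support ensures that a cut edge chosen on one side has positive value, hence lies in a
-- matching of the other side.
DecomposableFor : ∀ {k m} → Multigraph k m → Point m → Set
DecomposableFor {m = m} G b = ∀ (c : Point m) → ∃[ M ] Supported G b M × dot (χ M) c ≤ dot b c

-- All edge sets are compared. The claim about p is conditional on some matching M through e, so
-- that a price can be assigned to every edge, including those that lie in no supported matching.
cheapest : ∀ {k m} (G : Multigraph k m) b (c : Point m) e →
  ∃[ p ] ∀ M → Supported G b M → M e ≡ true →
    p ≤ dot (χ M) c × (∃[ N ] Supported G b N × N e ≡ true × dot (χ N) c ≡ p)
cheapest G b c e
  with minimise {P = λ i → Supported G b (subsetAt i) × subsetAt i e ≡ true}
         (λ i → supported? G b (subsetAt i) ×-dec (subsetAt i e Boolₚ.≟ true)) (λ i → dot (χ (subsetAt i)) c)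
... | inj₁ (i , (sup , ie) , best) = dot (χ (subsetAt i)) c , λ M supM Me →
        subst (dot (χ (subsetAt i)) c ≤_) (dot-cong {y = c} (λ h → cong 𝟙 (subsetAt-indexOf M h)) (λ _ → refl))
          (best (indexOf M) (candidate M supM Me)) ,
        subsetAt i , sup , ie , refl
  where
  candidate : ∀ M → Supported G b M → M e ≡ true →
    Supported G b (subsetAt (indexOf M)) × subsetAt (indexOf M) e ≡ true
  candidate M supM Me = supported-cong G b (λ h → sym (subsetAt-indexOf M h)) supM ,
    trans (subsetAt-indexOf M e) Me
-- No supported matching contains e, so the price 0 is a default that no M ever tests.
... | inj₂ none = 0ℚ , λ M supM Me → ⊥-elim (none (indexOf M)
        (supported-cong G b (λ h → sym (subsetAt-indexOf M h)) supM , trans (subsetAt-indexOf M e) Me))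

-- For the cost that is -1 on e and 0 elsewhere, b has negative cost, so the matching obtained must
-- contain e.
covering-matching : ∀ {k m} (G : Multigraph k m) b → DecomposableFor G b → ∀ e → 0ℚ < b e →
  ∃[ M ] Supported G b M × M e ≡ true
covering-matching G b dec e 0<be with dec (λ h → - unit e h)
... | M , sup , le = M , sup , in-M (M e) refl
  where
  value : ∀ x → dot x (λ h → - unit e h) ≡ - x e
  value x = trans (dot-negʳ x (unit e)) (cong -_ (trans (dot-comm x (unit e))
    (trans (dot-single (unit e) x e (λ j j≢e → unit-other (≢-sym j≢e)))
      (trans (cong (_* x e) (unit-self e)) (*-identityˡ (x e))))))
  in-M : ∀ a → M e ≡ a → M e ≡ true
  in-M true  Me = Me
  in-M false Me = ⊥-elim (<-irrefl refl (<-≤-trans (neg-antimono-< 0<be)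
      (subst₂ _≤_ (trans (value (χ M)) (cong (λ a → - 𝟙 a) Me)) (value b) le)))

cut-edge : ∀ {m} (M D : Subset m) → card (λ e → M e ∧ D e) ≡ 1 →
  ∃[ e ] M e ≡ true × D e ≡ true × (∀ h → M h ≡ true → D h ≡ true → h ≡ e)
cut-edge M D one with card≡1⇒singleton one
... | e , eq , unique = e , ∧-left (M e) eq , ∧-right (M e) eq , λ h Mh Dh → unique h (cong₂ _∧_ Mh Dh)
  where
  ∧-left : ∀ a {b} → a ∧ b ≡ true → a ≡ true
  ∧-left true _ = refl
  ∧-right : ∀ a {b} → a ∧ b ≡ true → b ≡ true
  ∧-right true eq = eq

-- Gluing matchings along a tight cut

module Gluing {k m} (G : Multigraph k m) {b : Point m} (feas : Feasible G b)
  (X : Subset k) where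

  X̄ : Subset k
  X̄ v = not (X v)

  module In  = Contraction G X
  module Out = Contraction G X̄

  D inner : Subset m
  D = δ G X
  inner e = X (proj₁ (G e)) ∧ X (proj₂ (G e))

  CheapestInside : Point m → Fin m → ℚ → Set
  CheapestInside a e p = ∀ M → Supported In.G/ (In.restrict b) M → M e ≡ true →
    p ≤ dot (χ M) a × (∃[ N ] Supported In.G/ (In.restrict b) N × N e ≡ true × dot (χ N) a ≡ p)

  innerCost : Point m → Point m
  innerCost c e = 𝟙 (inner e) * c e

  -- The price of a cut edge is the least inner cost of a matching of the X side through it.
  -- Subtracting prices on the X side shows b·p ≤ b·a; adding them to the cost of the other
  -- side makes the matching found there pay for its completion inside X.
  module Costs (c price : Point m) (price-cheapest : ∀ e → CheapestInside (innerCost c) e (price e)) where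

    a : Point m
    a = innerCost c

    p : Point m
    p e = 𝟙 (D e) * price e

    dot-p : ∀ M e → M e ≡ true → D e ≡ true → (∀ h → M h ≡ true → D h ≡ true → h ≡ e) →
      dot (χ M) p ≡ price e
    dot-p M e Me De unique = trans (sum-single (λ h → χ M h * p h) e off)
      (trans (cong₂ (λ s t → 𝟙 s * (𝟙 t * price e)) Me De) (tidy (price e)))
      where
      tidy : ∀ x → 1ℚ * (1ℚ * x) ≡ x
      tidy = solve-∀ ℚ-ring
      off : ∀ h → h ≢ e → χ M h * p h ≡ 0ℚ
      off h h≢e with M h in Mh | D h in Dh
      ... | false | t     = *-zeroˡ (𝟙 t * price h)
      ... | true  | false = cong (1ℚ *_) (*-zeroˡ (price h))
      ... | true  | true  = ⊥-elim (h≢e (unique h Mh Dh))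

    in-cost : Point m
    in-cost e = 1ℚ * a e + - 1ℚ * p e

    -- Zero on the edges inside X; on a cut edge it is the original cost plus the price of
    -- completing the matching within X.
    out-cost : Point m
    out-cost e = 1ℚ * (1ℚ * c e + - 1ℚ * a e) + 1ℚ * p e

    -- A supported matching of the X side has inner cost at least the price of its single cut edge,
    -- so its `in-cost` is nonnegative. The matching that `dec` supplies carries this bound over to
    -- b. Restricting b is harmless, as `in-cost` vanishes on edges without an end in X.
    b·p≤b·a : DecomposableFor In.G/ (In.restrict b) → dot b p ≤ dot b a
    b·p≤b·a dec with dec in-cost
    ... | M , sup , le with cut-edge M D (In.perfect-cut (proj₁ sup))
    ...   | e , Me , De , unique = ≤-slack (dot b a - dot b p)
      (subst (0ℚ ≤_) unrestrict (≤-trans 0≤M le)) (cancel (dot b p) (dot b a))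
      where
      cancel : ∀ x y → y ≡ x + (y - x)
      cancel = solve-∀ ℚ-ring
      difference : ∀ x y → 1ℚ * x + - 1ℚ * y ≡ x - y
      difference = solve-∀ ℚ-ring
      0≤M : 0ℚ ≤ dot (χ M) in-cost
      0≤M = subst (0ℚ ≤_) (sym (trans (dot-linʳ (χ M) 1ℚ a (- 1ℚ) p)
              (trans (difference (dot (χ M) a) (dot (χ M) p))
                     (cong (λ x → dot (χ M) a - x) (dot-p M e Me De unique)))))
        (0≤-diff (proj₁ (price-cheapest e M sup Me)))
      unrestrict : dot (In.restrict b) in-cost ≡ dot b a - dot b p
      unrestrict = trans (sum-cong pointwise) (trans (dot-linʳ b 1ℚ a (- 1ℚ) p) (difference (dot b a) (dot b p)))
        where
        vanish : ∀ x y z → 0ℚ * (1ℚ * (0ℚ * x) + - 1ℚ * (0ℚ * y)) ≡ z * (1ℚ * (0ℚ * x) + - 1ℚ * (0ℚ * y))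
        vanish = solve-∀ ℚ-ring
        pointwise : ∀ e → In.restrict b e * in-cost e ≡ b e * in-cost e
        pointwise e with X (proj₁ (G e)) | X (proj₂ (G e))
        ... | true  | _     = refl
        ... | false | true  = refl
        ... | false | false = vanish (c e) (price e) (b e)

    module Glue (M N : Subset m) (supM : Supported In.G/ (In.restrict b) M)
      (supN : Supported Out.G/ (Out.restrict b) N) (agree : ∀ e → D e ≡ true → M e ≡ N e) where

      -- Cut edges are read off from N; by `agree` M would give the same ones.
      M∪N : Subset m
      M∪N e = if inner e then M e else N e

      cost : dot (χ M∪N) c ≡ dot (χ M) a + dot (χ N) (λ e → 1ℚ * c e + - 1ℚ * a e)
      cost = trans (sum-cong pointwise) (sum-+ (λ e → χ M e * a e) (λ e → χ N e * (1ℚ * c e + - 1ℚ * a e)))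
        where
        keep : ∀ x y z → x * z ≡ x * (1ℚ * z) + y * (1ℚ * z + - 1ℚ * (1ℚ * z))
        keep = solve-∀ ℚ-ring
        drop : ∀ x y z → y * z ≡ x * (0ℚ * z) + y * (1ℚ * z + - 1ℚ * (0ℚ * z))
        drop = solve-∀ ℚ-ring
        pointwise : ∀ e → χ M∪N e * c e ≡ χ M e * a e + χ N e * (1ℚ * c e + - 1ℚ * a e)
        pointwise e with inner e
        ... | true  = keep (χ M e) (χ N e) (c e)
        ... | false = drop (χ M e) (χ N e) (c e)

      restrict-pos : ∀ (t : Bool) {q} → 0ℚ < (if t then q else 0ℚ) → 0ℚ < q
      restrict-pos true  0<q = 0<q
      restrict-pos false 0<0 = ⊥-elim (<-irrefl refl 0<0)

      positive-support : ∀ e → M∪N e ≡ true → 0ℚ < b e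
      positive-support e eq with inner e
      ... | true  = restrict-pos (In.touches e) (proj₂ supM e eq)
      ... | false = restrict-pos (Out.touches e) (proj₂ supN e eq)

      incident-X : ∀ v e → δ G (v ==_) e ≡ true → X v ≡ true → inner e ≡ false → D e ≡ true
      incident-X v e at Xv with v F.≟ proj₁ (G e) | v F.≟ proj₂ (G e)
      ... | yes refl | no _     = λ eq → cong₂ _xor_ Xv (second (X v) Xv eq)
        where
        second : ∀ s {t} → s ≡ true → s ∧ t ≡ false → t ≡ false
        second true _ eq = eq
      ... | no _     | yes refl = λ eq → cong₂ _xor_ (first (X (proj₁ (G e))) Xv eq) Xv
        where
        first : ∀ s {t} → t ≡ true → s ∧ t ≡ false → s ≡ false
        first true  refl ()
        first false _    _ = refl
      ... | yes _    | yes _    = case at of λ ()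
      ... | no _     | no _     = case at of λ ()

      incident-X̄ : ∀ v e → δ G (v ==_) e ≡ true → X v ≡ false → inner e ≡ false
      incident-X̄ v e at Xv with v F.≟ proj₁ (G e) | v F.≟ proj₂ (G e)
      ... | yes refl | _        = cong (_∧ X (proj₂ (G e))) Xv
      ... | no _     | yes refl = trans (cong (X (proj₁ (G e)) ∧_) Xv) (Boolₚ.∧-zeroʳ (X (proj₁ (G e))))
      ... | no _     | no _     = case at of λ ()

      perfect : Perfect G M∪N
      perfect v with X v in Xv
      -- The star of a vertex of X consists of inner edges and cut edges, and on the latter N equals
      -- M. The star of any other vertex contains no inner edge.
      ... | true  = trans (card-cong pointwise) (In.perfect-inside (proj₁ supM) v Xv)
        where
        pointwise : ∀ e → M∪N e ∧ δ G (v ==_) e ≡ M e ∧ δ G (v ==_) e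
        pointwise e with δ G (v ==_) e in at
        ... | false = trans (Boolₚ.∧-zeroʳ (M∪N e)) (sym (Boolₚ.∧-zeroʳ (M e)))
        ... | true with inner e in eq
        ...   | true  = refl
        ...   | false = cong (_∧ true) (sym (agree e (incident-X v e at Xv eq)))
      ... | false = trans (card-cong pointwise) (Out.perfect-inside (proj₁ supN) v (cong not Xv))
        where
        pointwise : ∀ e → M∪N e ∧ δ G (v ==_) e ≡ N e ∧ δ G (v ==_) e
        pointwise e with δ G (v ==_) e in at
        ... | false = trans (Boolₚ.∧-zeroʳ (M∪N e)) (sym (Boolₚ.∧-zeroʳ (N e)))
        ... | true with inner e in eq
        ...   | true  = case trans (sym eq) (incident-X̄ v e at Xv) of λ ()
        ...   | false = refl

    -- The side outside X chooses first and thereby fixes the cut edge e₀. The X side only has to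
    -- complete it, at the cost that the first choice has already paid through `out-cost`.
    glued : DecomposableFor In.G/ (In.restrict b) → DecomposableFor Out.G/ (Out.restrict b) →
      ∃[ M ] Supported G b M × dot (χ M) c ≤ dot b c
    glued decIn decOut with decOut out-cost
    ... | N , supN , le with cut-edge N D
        (trans (card-cong (λ e → cong (N e ∧_) (sym (δ-complement G X e)))) (Out.perfect-cut (proj₁ supN)))
    ...   | e₀ , Ne₀ , De₀ , uniqueN with covering-matching In.G/ (In.restrict b) decIn e₀ 0<be₀
      where
      crossing : ∀ s t (q : ℚ) → s xor t ≡ true → (if not s ∨ not t then q else 0ℚ) ≡ (if s ∨ t then q else 0ℚ)
      crossing true  false q _ = refl
      crossing false true  q _ = refl
      0<be₀ : 0ℚ < In.restrict b e₀
      0<be₀ = subst (0ℚ <_) (crossing (X (proj₁ (G e₀))) (X (proj₂ (G e₀))) (b e₀) De₀) (proj₂ supN e₀ Ne₀)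
    -- `M₀` only witnesses that e₀ lies in some supported matching of the X side; the price lemma
    -- trades it for one whose inner cost equals the price of e₀.
    ...     | M₀ , supM₀ , M₀e₀ with proj₂ (price-cheapest e₀ M₀ supM₀ M₀e₀)
    ...       | M , supM , Me₀ , cost-M with cut-edge M D (In.perfect-cut (proj₁ supM))
    ...         | e₁ , Me₁ , De₁ , uniqueM = M∪N , (perfect , positive-support) , bound
      where
      agree : ∀ e → D e ≡ true → M e ≡ N e
      agree e De with M e in Me | N e in Ne
      ... | true  | true  = refl
      ... | false | false = refl
      ... | true  | false with trans (uniqueM e Me De) (sym (uniqueM e₀ Me₀ De₀))
      ...   | refl = case trans (sym Ne) Ne₀ of λ ()
      agree e De | false | true with uniqueN e Ne De
      ...   | refl = case trans (sym Me) Me₀ of λ ()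
      open Glue M N supM supN agree
      rest : Point m
      rest e = 1ℚ * c e + - 1ℚ * a e
      bound : dot (χ M∪N) c ≤ dot b c
      bound = begin
        dot (χ M∪N) c                           ≡⟨ cost ⟩
        dot (χ M) a + dot (χ N) rest            ≡⟨ cong (_+ dot (χ N) rest) (trans cost-M (sym (dot-p N e₀ Ne₀ De₀ uniqueN))) ⟩
        dot (χ N) p + dot (χ N) rest            ≡⟨ tidy₁ (dot (χ N) p) (dot (χ N) rest) ⟩
        1ℚ * dot (χ N) rest + 1ℚ * dot (χ N) p  ≡⟨ sym (dot-linʳ (χ N) 1ℚ rest 1ℚ p) ⟩
        dot (χ N) out-cost                      ≤⟨ le ⟩
        dot (Out.restrict b) out-cost           ≡⟨ sum-cong pointwise ⟩
        dot b out-cost                          ≡⟨ dot-linʳ b 1ℚ rest 1ℚ p ⟩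
        1ℚ * dot b rest + 1ℚ * dot b p          ≡⟨ cong (λ x → 1ℚ * x + 1ℚ * dot b p) (dot-linʳ b 1ℚ c (- 1ℚ) a) ⟩
        1ℚ * (1ℚ * dot b c + - 1ℚ * dot b a) + 1ℚ * dot b p
          ≤⟨ ≤-slack (dot b a - dot b p) (0≤-diff (b·p≤b·a decIn)) (tidy₂ (dot b c) (dot b a) (dot b p)) ⟩
        dot b c ∎
        where
        open ≤-Reasoning
        tidy₁ : ∀ x y → x + y ≡ 1ℚ * y + 1ℚ * x
        tidy₁ = solve-∀ ℚ-ring
        tidy₂ : ∀ x y z → x ≡ 1ℚ * (1ℚ * x + - 1ℚ * y) + 1ℚ * z + (y - z)
        tidy₂ = solve-∀ ℚ-ring
        vanish : ∀ x y z → 0ℚ * (1ℚ * (1ℚ * x + - 1ℚ * (1ℚ * x)) + 1ℚ * (0ℚ * y)) ≡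
          z * (1ℚ * (1ℚ * x + - 1ℚ * (1ℚ * x)) + 1ℚ * (0ℚ * y))
        vanish = solve-∀ ℚ-ring
        pointwise : ∀ e → Out.restrict b e * out-cost e ≡ b e * out-cost e
        pointwise e with X (proj₁ (G e)) | X (proj₂ (G e))
        ... | true  | true  = vanish (c e) (price e) (b e)
        ... | true  | false = refl
        ... | false | _     = refl

  glue : DecomposableFor In.G/ (In.restrict b) → DecomposableFor Out.G/ (Out.restrict b) →
    DecomposableFor G b
  glue decIn decOut c = Costs.glued c (λ e → proj₁ (cheapest In.G/ (In.restrict b) (innerCost c) e))
    (λ e → proj₂ (cheapest In.G/ (In.restrict b) (innerCost c) e)) decIn decOut

-- Cuts and supports

weight-singleton : ∀ {k m} (G : Multigraph k m) b {q} → (∀ v → weight G b (v ==_) ≡ q) →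
  ∀ X → card X ≡ 1 → weight G b X ≡ q
weight-singleton G b deg X one with card≡1⇒singleton one
... | v , Xv , unique = trans (weight-cong G b X≗v) (deg v)
  where
  X≗v : ∀ w → X w ≡ (v == w)
  X≗v w with v F.≟ w
  ... | yes refl = Xv
  ... | no  v≢w with X w in Xw
  ...   | true  = ⊥-elim (v≢w (sym (unique w Xw)))
  ...   | false = refl

weight-cosingleton : ∀ {k m} (G : Multigraph k m) b {q} → (∀ v → weight G b (v ==_) ≡ q) →
  ∀ X → card (λ v → not (X v)) ≡ 1 → weight G b X ≡ q
weight-cosingleton G b deg X one = trans (sym (weight-complement G b X))
  (weight-singleton G b deg (λ v → not (X v)) one)

weight-lin : ∀ {k m} (G : Multigraph k m) s (b : Point m) t (d : Point m) X →
  weight G (λ e → s * b e + t * d e) X ≡ s * weight G b X + t * weight G d X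
weight-lin G s b t d X = dot-linʳ (χ (δ G X)) s b t d

perfect-degree : ∀ {k m} (G : Multigraph k m) {M} → Perfect G M → ∀ v → weight G (χ M) (v ==_) ≡ 1ℚ
perfect-degree G {M} pm v with cut-edge M (δ G (v ==_)) (pm v)
... | e , Me , De , unique = trans (sum-single (λ h → χ (δ G (v ==_)) h * χ M h) e off)
  (cong₂ (λ x y → 𝟙 x * 𝟙 y) De Me)
  where
  off : ∀ h → h ≢ e → χ (δ G (v ==_)) h * χ M h ≡ 0ℚ
  off h h≢e with δ G (v ==_) h in Dh | M h in Mh
  ... | false | t     = *-zeroˡ (𝟙 t)
  ... | true  | false = refl
  ... | true  | true  = ⊥-elim (h≢e (unique h Mh Dh))

support : ∀ {m} → Point m → Subset m
support b e = ⌊ 0ℚ <? b e ⌋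

support⇒> : ∀ {m} (b : Point m) {e} → support b e ≡ true → 0ℚ < b e
support⇒> b {e} eq with 0ℚ <? b e
... | yes 0<be = 0<be
... | no  _    = case eq of λ ()

>⇒support : ∀ {m} (b : Point m) {e} → 0ℚ < b e → support b e ≡ true
>⇒support b {e} 0<be with 0ℚ <? b e
... | yes _   = refl
... | no  ≮be = ⊥-elim (≮be 0<be)

nonsupport⇒0 : ∀ {m} (b : Point m) → (∀ e → 0ℚ ≤ b e) → ∀ {e} → support b e ≡ false → b e ≡ 0ℚ
nonsupport⇒0 b b≥0 {e} eq with 0ℚ <? b e
... | yes _   = case eq of λ ()
... | no  ≮be = ≤-antisym (≮⇒≥ ≮be) (b≥0 e)

positive-edge : ∀ {k m} (G : Multigraph k m) b → (∀ e → 0ℚ ≤ b e) → ∀ X → weight G b X ≡ 1ℚ →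
  ∃[ e ] support b e ∧ δ G X e ≡ true
positive-edge {m = m} G b b≥0 X one with Fₚ.any? (λ e → (support b e ∧ δ G X e) Boolₚ.≟ true)
... | yes found = found
... | no  none  = ⊥-elim (1≢0 (trans (sym one) (trans (sum-cong vanish) (sum-0 m))))
  where
  vanish : ∀ e → χ (δ G X) e * b e ≡ 0ℚ
  vanish e with support b e in pos | δ G X e in cut
  ... | _     | false = *-zeroˡ (b e)
  ... | false | true  = trans (cong (1ℚ *_) (nonsupport⇒0 b b≥0 pos)) (*-zeroʳ 1ℚ)
  ... | true  | true  = ⊥-elim (none (e , cong₂ _∧_ pos cut))

-- Moving b along a direction

between : ∀ {a s ε ε′} → 0ℚ ≤ a → 0ℚ ≤ ε → ε ≤ ε′ → 0ℚ ≤ a + ε′ * s → 0ℚ ≤ a + ε * s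
between {a} {s} {ε} {ε′} 0≤a 0≤ε ε≤ε′ 0≤end with s <? 0ℚ
... | no  s≮0 = 0≤+ 0≤a (0≤* 0≤ε (≮⇒≥ s≮0))
-- With negative slope the value at ε is at least the value at the later ε′.
... | yes s<0 = ≤-trans 0≤end (≤-slack ((ε′ - ε) * - s) (0≤* (0≤-diff ε≤ε′) (<⇒≤ (0<neg s<0))) (regroup a s ε ε′))
  where
  regroup : ∀ a s x y → a + x * s ≡ a + y * s + (y - x) * - s
  regroup = solve-∀ ℚ-ring

module Step {k m} (G : Multigraph k m) (even : par k ≡ false)
  (smaller : ∀ {j} → 0 ℕ.< j → j ℕ.< k → par j ≡ false → ∀ (H : Multigraph j m) {b} → Feasible H b → DecomposableFor H b)
  where

  -- An odd number other than 1 is at least 3, and each contraction replaces one side by a single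
  -- vertex. So both contracted graphs are smaller than G, and their orders, one more than an odd
  -- number, are even.
  tight-cut : ∀ {b} → Feasible G b → ∀ X → par (card X) ≡ true → card X ≢ 1 → card (λ v → not (X v)) ≢ 1 →
    weight G b X ≡ 1ℚ → DecomposableFor G b
  tight-cut {b} feas X odd X≢1 X̄≢1 tight = glue
    (smaller (ℕ.s≤s ℕ.z≤n) (bound X X̄≢1 odd′) (cong not odd) In.G/ (In.feasible/ feas even odd tight))
    (smaller (ℕ.s≤s ℕ.z≤n) (subst (suc (card X̄) ℕ.<_) (trans (ℕₚ.+-comm (card X̄) (card X)) (card-complement X))
               (grow (card X̄) (card X) odd X≢1)) (cong not odd′) Out.G/
      (Out.feasible/ feas even odd′ (trans (weight-complement G b X) tight)))
    where
    open Gluing G feas X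
    odd′ : par (card X̄) ≡ true
    odd′ = odd-complement X even odd
    grow : ∀ a c → par c ≡ true → c ≢ 1 → suc a ℕ.< a ℕ.+ c
    grow a (suc zero)    _ c≢1 = ⊥-elim (c≢1 refl)
    grow a (suc (suc c)) _ _   = subst (suc (suc a) ℕ.≤_) (sym (trans (ℕₚ.+-suc a (suc c)) (cong suc (ℕₚ.+-suc a c))))
      (ℕ.s≤s (ℕ.s≤s (ℕₚ.m≤m+n a c)))
    bound : ∀ X → card (λ v → not (X v)) ≢ 1 → par (card (λ v → not (X v))) ≡ true → suc (card X) ℕ.< k
    bound X X̄≢1 odd′ = subst (suc (card X) ℕ.<_) (card-complement X) (grow (card X) (card (λ v → not (X v))) odd′ X̄≢1)

  FewerPositive : Point m → Set
  FewerPositive b = ∀ {b′} → Feasible G b′ → card (support b′) ℕ.< card (support b) → DecomposableFor G b′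

  -- Along d the degrees stay fixed and the cost does not increase, and no edge outside the support
  -- of b gains value. So any matching found for a feasible b + ε d also serves b.
  module Move {b : Point m} (feas : Feasible G b) (fewer : FewerPositive b) (c d : Point m)
    (supported : ∀ e → b e ≡ 0ℚ → d e ≡ 0ℚ) (annihilated : ∀ v → weight G d (v ==_) ≡ 0ℚ)
    (descending : dot d c ≤ 0ℚ) where

    open Feasible feas

    moved : ℚ → Point m
    moved ε e = 1ℚ * b e + ε * d e

    moved-weight : ∀ ε X → weight G (moved ε) X ≡ weight G b X + ε * weight G d X
    moved-weight ε X = trans (weight-lin G 1ℚ b ε d X) (cong (_+ ε * weight G d X) (*-identityˡ (weight G b X)))

    slack slope : Subset k → ℚ
    slack X = weight G b X - 1ℚ
    slope X = weight G d X

    moved-feasible : ∀ ε → (∀ e → 0ℚ ≤ b e + ε * d e) →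
      (∀ X → par (card X) ≡ true → 0ℚ ≤ slack X + ε * slope X) → Feasible G (moved ε)
    moved-feasible ε edges cuts = record
      { nonneg = λ e → subst (0ℚ ≤_) (cong (_+ ε * d e) (sym (*-identityˡ (b e)))) (edges e)
      ; noloop = λ e loop → trans (cong₂ (λ x y → 1ℚ * x + ε * y) (noloop e loop) (supported e (noloop e loop))) (zeros ε)
      ; degree = λ v → trans (moved-weight ε (v ==_)) (trans (cong₂ (λ x y → x + ε * y) (degree v) (annihilated v)) (one ε))
      ; oddcut = λ X odd → ≤-slack (slack X + ε * slope X) (cuts X odd)
          (trans (moved-weight ε X) (regroup (weight G b X) (ε * slope X)))
      }
      where
      zeros : ∀ x → 1ℚ * 0ℚ + x * 0ℚ ≡ 0ℚ
      zeros = solve-∀ ℚ-ring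
      one : ∀ x → 1ℚ + x * 0ℚ ≡ 1ℚ
      one = solve-∀ ℚ-ring
      regroup : ∀ x y → x + y ≡ 1ℚ + (x - 1ℚ + y)
      regroup = solve-∀ ℚ-ring

    moved-0 : ∀ ε e → b e ≡ 0ℚ → moved ε e ≡ 0ℚ
    moved-0 ε e be≡0 = trans (cong₂ (λ x y → 1ℚ * x + ε * y) be≡0 (supported e be≡0)) (zeros ε)
      where
      zeros : ∀ x → 1ℚ * 0ℚ + x * 0ℚ ≡ 0ℚ
      zeros = solve-∀ ℚ-ring

    moved-positive : ∀ ε e → 0ℚ < moved ε e → 0ℚ < b e
    moved-positive ε e 0<moved with 0ℚ <? b e
    ... | yes 0<be = 0<be
    ... | no  ≮be  = ⊥-elim (<-irrefl (sym (moved-0 ε e (≤-antisym (≮⇒≥ ≮be) (nonneg e)))) 0<moved)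

    transfer : ∀ ε → 0ℚ ≤ ε → DecomposableFor G (moved ε) → ∃[ M ] Supported G b M × dot (χ M) c ≤ dot b c
    transfer ε 0≤ε dec with dec c
    ... | M , (pm , pos) , le = M , (pm , λ e Me → moved-positive ε e (pos e Me)) ,
      ≤-trans le (≤-slack (ε * (0ℚ - dot d c)) (0≤* 0≤ε (0≤-diff descending))
        (trans (regroup (dot b c) ε (dot d c)) (cong (_+ ε * (0ℚ - dot d c)) (sym (dot-linˡ 1ℚ b ε d c)))))
      where
      regroup : ∀ x e y → x ≡ 1ℚ * x + e * y + e * (0ℚ - y)
      regroup = solve-∀ ℚ-ring

    edge-dies : ∀ ε → 0ℚ ≤ ε → Feasible G (moved ε) → ∀ e → d e < 0ℚ → b e + ε * d e ≡ 0ℚ →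
      ∃[ M ] Supported G b M × dot (χ M) c ≤ dot b c
    edge-dies ε 0≤ε feas′ e de<0 dead = transfer ε 0≤ε (fewer feas′ drop)
      where
      0<be : 0ℚ < b e
      0<be with 0ℚ <? b e
      ... | yes 0<be = 0<be
      ... | no  ≮be  = ⊥-elim (<-irrefl (supported e (≤-antisym (≮⇒≥ ≮be) (nonneg e))) de<0)
      drop : card (support (moved ε)) ℕ.< card (support b)
      drop = subst (card (support (moved ε)) ℕ.<_) (sym (card-without (support b) e (>⇒support b 0<be)))
        (ℕ.s≤s (card-mono still-positive))
        where
        still-positive : ∀ h → support (moved ε) h ≡ true → (support b without e) h ≡ true
        still-positive h pos with h F.≟ e
        ... | yes refl = ⊥-elim (<-irrefl (sym (trans (cong (_+ ε * d e) (*-identityˡ (b e))) dead)) (support⇒> (moved ε) pos))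
        ... | no  h≢e  = trans (without-other (support b) h≢e)
                (>⇒support b (moved-positive ε h (support⇒> (moved ε) pos)))

    cut-tightens : ∀ ε → 0ℚ ≤ ε → Feasible G (moved ε) → ∀ X → par (card X) ≡ true → slope X < 0ℚ →
      slack X + ε * slope X ≡ 0ℚ → ∃[ M ] Supported G b M × dot (χ M) c ≤ dot b c
    cut-tightens ε 0≤ε feas′ X odd slope<0 tight = transfer ε 0≤ε (tight-cut feas′ X odd
      -- Since d has degree 0 at every vertex, trivial cuts have slope 0; a cut of negative slope is
      -- therefore nontrivial.
      (λ one → <-irrefl (weight-singleton G d annihilated X one) slope<0)
      (λ one → <-irrefl (weight-cosingleton G d annihilated X one) slope<0)
      (trans (moved-weight ε X) (trans (regroup (weight G b X) (ε * slope X)) (trans (cong (1ℚ +_) tight) (+-identityʳ 1ℚ)))))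
      where
      regroup : ∀ x y → x + y ≡ 1ℚ + (x - 1ℚ + y)
      regroup = solve-∀ ℚ-ring

    slack≥0 : ∀ X → par (card X) ≡ true → 0ℚ ≤ slack X
    slack≥0 X odd = 0≤-diff (oddcut X odd)

    all-cuts : ∀ ε → (∀ i → par (card (subsetAt {k} i)) ≡ true → 0ℚ ≤ slack (subsetAt i) + ε * slope (subsetAt i)) →
      ∀ X → par (card X) ≡ true → 0ℚ ≤ slack X + ε * slope X
    all-cuts ε listed X odd = subst₂ (λ x y → 0ℚ ≤ x - 1ℚ + ε * y)
      (weight-cong G b (subsetAt-indexOf X)) (weight-cong G d (subsetAt-indexOf X))
      (listed (indexOf X) (trans (cong par (card-cong (subsetAt-indexOf X))) odd))

    -- The step ε₁ is where an edge first dies and ε₂, if it exists, where an odd cut first becomes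
    -- tight. The smaller one keeps b feasible and decides which induction applies. The negative
    -- entry of d guarantees that ε₁ exists.
    move : ∃[ e ] d e < 0ℚ → ∃[ M ] Supported G b M × dot (χ M) c ≤ dot b c
    move (e₀ , de₀<0) with ratio-test {P = λ _ → ⊤} (λ _ → yes tt) b d (λ e _ → nonneg e)
    ... | inj₁ d≥0 = ⊥-elim (<-irrefl refl (<-≤-trans de₀<0 (d≥0 e₀ tt)))
    ... | inj₂ (ε₁ , 0≤ε₁ , edges , e , _ , de<0 , dead)
      with ratio-test {P = λ i → par (card (subsetAt {k} i)) ≡ true} (λ i → par (card (subsetAt {k} i)) Boolₚ.≟ true)
             (λ i → slack (subsetAt i)) (λ i → slope (subsetAt i)) (λ i → slack≥0 (subsetAt i))
    ...   | inj₁ slope≥0 = edge-dies ε₁ 0≤ε₁ (moved-feasible ε₁ (λ h → edges h tt)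
            (all-cuts ε₁ λ i odd → 0≤+ (slack≥0 (subsetAt i) odd) (0≤* 0≤ε₁ (slope≥0 i odd)))) e de<0 dead
    ...   | inj₂ (ε₂ , 0≤ε₂ , cuts , i , odd , slope<0 , tight) with ≤-total ε₁ ε₂
    ...     | inj₁ ε₁≤ε₂ = edge-dies ε₁ 0≤ε₁ (moved-feasible ε₁ (λ h → edges h tt)
              (all-cuts ε₁ λ j oddj → between (slack≥0 (subsetAt j) oddj) 0≤ε₁ ε₁≤ε₂ (cuts j oddj))) e de<0 dead
    ...     | inj₂ ε₂≤ε₁ = cut-tightens ε₂ 0≤ε₂ (moved-feasible ε₂
              (λ h → between (nonneg h) 0≤ε₂ ε₂≤ε₁ (edges h tt)) (all-cuts ε₂ cuts)) (subsetAt i) odd slope<0 tight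

  module _ {b : Point m} (feas : Feasible G b) (fewer : FewerPositive b) where

    open Feasible feas

    -- A nonzero entry of d sits on an edge that is no loop, hence in the star of its first end.
    -- There d sums to 0, so it also takes a negative value.
    negative-entry : ∀ d → (∀ e → b e ≡ 0ℚ → d e ≡ 0ℚ) → (∀ v → weight G d (v ==_) ≡ 0ℚ) →
      ∃[ e ] d e ≢ 0ℚ → ∃[ e ] d e < 0ℚ
    negative-entry d supported annihilated (e , de≢0) = at-vertex
      (sum≡0⇒negative (λ h → χ (δ G (v ==_)) h * d h) (annihilated v) e (λ eq → de≢0 (trans (sym term) eq)))
      where
      v = proj₁ (G e)
      term : χ (δ G (v ==_)) e * d e ≡ d e
      term rewrite ==-refl v | ≢⇒== {i = v} {proj₂ (G e)} (λ loop → de≢0 (supported e (noloop e loop))) = *-identityˡ (d e)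
      at-vertex : ∃[ h ] χ (δ G (v ==_)) h * d h < 0ℚ → ∃[ h ] d h < 0ℚ
      at-vertex (h , neg) with δ G (v ==_) h
      ... | true  = h , subst (_< 0ℚ) (*-identityˡ (d h)) neg
      ... | false = ⊥-elim (<-irrefl (*-zeroˡ (d h)) neg)

    -- The conditions on d are symmetric under negation, and one of d and its negative does not
    -- increase the cost.
    descend : ∀ d → (∀ e → b e ≡ 0ℚ → d e ≡ 0ℚ) → (∀ v → weight G d (v ==_) ≡ 0ℚ) →
      ∃[ e ] d e ≢ 0ℚ → DecomposableFor G b
    descend d supported annihilated (e , de≢0) c with ≤-total (dot d c) 0ℚ
    ... | inj₁ d·c≤0 = Move.move feas fewer c d supported annihilated d·c≤0
            (negative-entry d supported annihilated (e , de≢0))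
    ... | inj₂ 0≤d·c = Move.move feas fewer c -d supported′ annihilated′ -d·c≤0
            (negative-entry -d supported′ annihilated′ (e , λ -de≡0 → de≢0 (neg-injective -de≡0)))
      where
      -d : Point m
      -d h = - d h
      supported′ : ∀ h → b h ≡ 0ℚ → -d h ≡ 0ℚ
      supported′ h bh≡0 = cong -_ (supported h bh≡0)
      annihilated′ : ∀ v → weight G -d (v ==_) ≡ 0ℚ
      annihilated′ v = trans (dot-negʳ (χ (δ G (v ==_))) d) (cong -_ (annihilated v))
      -d·c≤0 : dot -d c ≤ 0ℚ
      -d·c≤0 = subst (_≤ 0ℚ) (sym (dot-negˡ d c)) (neg-antimono-≤ 0≤d·c)

    -- M and b have the same degrees and M lies in the support of b, so their difference is an
    -- admissible direction. If it is zero, b is M itself and costs the same for every c.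
    via-matching : ∀ M → Supported G b M → DecomposableFor G b
    via-matching M (pm , pos) with Fₚ.any? (λ e → ¬? ((1ℚ * χ M e + - 1ℚ * b e) ≟ 0ℚ))
    ... | yes nonzero = descend (λ e → 1ℚ * χ M e + - 1ℚ * b e) supported annihilated nonzero
      where
      supported : ∀ e → b e ≡ 0ℚ → 1ℚ * χ M e + - 1ℚ * b e ≡ 0ℚ
      supported e be≡0 with M e in Me
      ... | true  = ⊥-elim (<-irrefl (sym be≡0) (pos e Me))
      ... | false rewrite be≡0 = refl
      annihilated : ∀ v → weight G (λ e → 1ℚ * χ M e + - 1ℚ * b e) (v ==_) ≡ 0ℚ
      annihilated v = trans (weight-lin G 1ℚ (χ M) (- 1ℚ) b (v ==_))
        (cong₂ (λ x y → 1ℚ * x + - 1ℚ * y) (perfect-degree G pm v) (degree v))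
    ... | no all-zero = λ c → M , (pm , pos) , ≤-reflexive (dot-cong {y = c} equal (λ _ → refl))
      where
      recover : ∀ x y → x ≡ (1ℚ * x + - 1ℚ * y) + y
      recover = solve-∀ ℚ-ring
      equal : ∀ e → χ M e ≡ b e
      equal e = trans (recover (χ M e) (b e)) (trans (cong (_+ b e)
        (decidable-stable ((1ℚ * χ M e + - 1ℚ * b e) ≟ 0ℚ) (λ ≢0 → all-zero (e , ≢0)))) (+-identityˡ (b e)))

    many-edges : k ℕ.< card (support b) → DecomposableFor G b
    many-edges k<edges with kernel k (λ v → χ (δ G (v ==_))) (support b) k<edges
    ... | d , supported , nonzero , annihilated = descend d supported′ annihilated nonzero
      where
      supported′ : ∀ e → b e ≡ 0ℚ → d e ≡ 0ℚ
      supported′ e be≡0 = supported e (not-positive (support b e) refl)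
        where
        not-positive : ∀ t → support b e ≡ t → support b e ≡ false
        not-positive false eq = eq
        not-positive true  eq = ⊥-elim (<-irrefl (sym be≡0) (support⇒> b eq))

∧-true : ∀ {a b} → a ∧ b ≡ true → a ≡ true × b ≡ true
∧-true {true} {true} _ = refl , refl

-- Small vertex sets

-- Chosen to unfold to the same term as the star `δ G (v ==_) e` of an edge e with ends p and q.
joins : ∀ {k} → Fin k → Fin k → Fin k → Bool
joins p q v = (v == p) xor (v == q)

support-loopless : ∀ {k m} {G : Multigraph k m} {b} → Feasible G b → ∀ e → 0ℚ < b e → proj₁ (G e) ≢ proj₂ (G e)
support-loopless feas e 0<be loop = <-irrefl (sym (Feasible.noloop feas e loop)) 0<be

two-vertices-joined : ∀ (p q v : Fin 2) → p ≡ q ⊎ joins p q v ≡ true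
two-vertices-joined = from-yes (Fₚ.all? λ (p : Fin 2) → Fₚ.all? λ (q : Fin 2) → Fₚ.all? λ (v : Fin 2) →
  (p F.≟ q) ⊎-dec (joins p q v Boolₚ.≟ true))

matching-2 : ∀ {m} (G : Multigraph 2 m) {b} → Feasible G b → ∃ (Supported G b)
matching-2 G {b} feas with positive-edge G b (Feasible.nonneg feas) (zero ==_) (Feasible.degree feas zero)
... | e , eq = (e ==_) , perfect , λ h e==h → subst (λ x → 0ℚ < b x) (==⇒≡ e==h) 0<be
  where
  0<be : 0ℚ < b e
  0<be = support⇒> b (proj₁ (∧-true eq))
  perfect : Perfect G (e ==_)
  perfect v with two-vertices-joined (proj₁ (G e)) (proj₂ (G e)) v
  ... | inj₁ loop = ⊥-elim (support-loopless feas e 0<be loop)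
  ... | inj₂ at   = card-singleton e (cong₂ _∧_ (==-refl e) at) (λ h eq → sym (==⇒≡ (proj₁ (∧-true eq))))

σ : Bool → ℚ
σ true  = 1ℚ
σ false = - 1ℚ

balance : ∀ {k} → Subset k → Subset k → ℚ
balance S T = sumℚ (λ v → σ (S v) * 𝟙 (T v))

Balanced : ℕ → Set
Balanced k = ∀ (p q : Fin k) → p ≡ q ⊎
  (sumℚ (λ v → σ (joins p q v)) ≡ 0ℚ × 0ℚ < balance (joins p q) (joins p q))

-- With +1 on the ends of one edge and -1 elsewhere, a second edge that is no loop gets 2, 0 or -2
-- according to the number of shared ends. On four vertices a negative value means that the two
-- edges partition the vertices.
OppositeOrHeavy : ℕ → Set
OppositeOrHeavy k = ∀ (p q x y : Fin k) → p ≡ q ⊎ x ≡ y ⊎ (∀ v → joins x y v ≡ not (joins p q v)) ⊎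
  0ℚ ≤ balance (joins p q) (joins x y)

four-balanced : Balanced 4
four-balanced = from-yes (Fₚ.all? λ (p : Fin 4) → Fₚ.all? λ (q : Fin 4) →
  (p F.≟ q) ⊎-dec ((sumℚ (λ v → σ (joins p q v)) ≟ 0ℚ) ×-dec (0ℚ <? balance (joins p q) (joins p q))))

four-oppositeOrHeavy : OppositeOrHeavy 4
four-oppositeOrHeavy = from-yes (Fₚ.all? λ (p : Fin 4) → Fₚ.all? λ (q : Fin 4) →
  Fₚ.all? λ (x : Fin 4) → Fₚ.all? λ (y : Fin 4) →
  (p F.≟ q) ⊎-dec ((x F.≟ y) ⊎-dec (Fₚ.all? (λ v → joins x y v Boolₚ.≟ not (joins p q v)) ⊎-dec
    (0ℚ ≤? balance (joins p q) (joins x y)))))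

-- With weight 1 on the ends of e and -1 on the other vertices the degrees of b sum to 0,
-- so some support edge joins exactly the vertices that e misses.
two-edge-matching : ∀ {k m} → Balanced k → OppositeOrHeavy k → Fin k →
  (G : Multigraph k m) → ∀ {b} → Feasible G b → ∃ (Supported G b)
two-edge-matching {k} {m} balanced heavy v₀ G {b} feas
  with positive-edge G b (Feasible.nonneg feas) (v₀ ==_) (Feasible.degree feas v₀)
... | e , eq = search (Fₚ.any? (λ f → (support b f Boolₚ.≟ true) ×-dec Fₚ.all? (λ v → at f v Boolₚ.≟ not (at e v))))
  where
  at : Fin m → Fin k → Bool
  at h = joins (proj₁ (G h)) (proj₂ (G h))
  0<be : 0ℚ < b e
  0<be = support⇒> b (proj₁ (∧-true eq))
  bal : Point m
  bal h = balance (at e) (at h)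
  facts : sumℚ (λ v → σ (at e v)) ≡ 0ℚ × 0ℚ < bal e
  facts with balanced (proj₁ (G e)) (proj₂ (G e))
  ... | inj₁ loop = ⊥-elim (support-loopless feas e 0<be loop)
  ... | inj₂ both = both
  total : dot bal b ≡ 0ℚ
  total = begin
    dot bal b                                              ≡⟨ dot-sumˡ (λ v → σ (at e v)) (λ v → χ (δ G (v ==_))) b ⟩
    dot (λ v → σ (at e v)) (λ v → weight G b (v ==_))      ≡⟨ dot-cong {x = λ v → σ (at e v)} (λ _ → refl) (Feasible.degree feas) ⟩
    dot (λ v → σ (at e v)) (λ _ → 1ℚ)                      ≡⟨ dot-1ʳ (λ v → σ (at e v)) ⟩
    sumℚ (λ v → σ (at e v))                                ≡⟨ proj₁ facts ⟩
    0ℚ                                                     ∎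
    where open ≡-Reasoning
  search : Dec (∃[ f ] support b f ≡ true × (∀ v → at f v ≡ not (at e v))) → ∃ (Supported G b)
  search (yes (f , sf , opposite)) = M , perfect , positive-M
    where
    M : Subset m
    M h = (e == h) ∨ (f == h)
    positive-M : ∀ h → M h ≡ true → 0ℚ < b h
    positive-M h Mh with e F.≟ h | f F.≟ h
    ... | yes refl | _        = 0<be
    ... | no _     | yes refl = support⇒> b sf
    ... | no _     | no _     = case Mh of λ ()
    perfect : Perfect G M
    perfect v with at e v in ev | opposite v
    ... | true  | fv = card-singleton e (cong₂ _∧_ (cong (_∨ (f == e)) (==-refl e)) ev) only
      where
      only : ∀ h → M h ∧ at h v ≡ true → h ≡ e
      only h hv with e F.≟ h | f F.≟ h
      ... | yes refl | _        = refl
      ... | no _     | yes refl = case trans (sym fv) hv of λ ()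
      ... | no _     | no _     = case hv of λ ()
    ... | false | fv = card-singleton f (cong₂ _∧_ (trans (cong ((e == f) ∨_) (==-refl f)) (Boolₚ.∨-zeroʳ (e == f))) fv) only
      where
      only : ∀ h → M h ∧ at h v ≡ true → h ≡ f
      only h hv with e F.≟ h | f F.≟ h
      ... | _        | yes refl = refl
      ... | yes refl | no _     = case trans (sym ev) hv of λ ()
      ... | no _     | no _     = case hv of λ ()
  -- Without an opposite edge every term of `total` is nonnegative and the term of e is positive, so
  -- the sum could not be 0.
  search (no none) = ⊥-elim (<-irrefl refl (<-≤-trans (0<* (proj₂ facts) 0<be)
    (subst (bal e * b e ≤_) total (term≤sum terms≥0 e))))
    where
    terms≥0 : ∀ h → 0ℚ ≤ bal h * b h
    terms≥0 h with support b h in sh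
    ... | false = ≤-reflexive (sym (trans (cong (bal h *_) (nonsupport⇒0 b (Feasible.nonneg feas) sh)) (*-zeroʳ (bal h))))
    ... | true with heavy (proj₁ (G e)) (proj₂ (G e)) (proj₁ (G h)) (proj₂ (G h))
    ...   | inj₁ loop                      = ⊥-elim (support-loopless feas e 0<be loop)
    ...   | inj₂ (inj₁ loop)               = ⊥-elim (support-loopless feas h (support⇒> b sh) loop)
    ...   | inj₂ (inj₂ (inj₁ opposite))    = ⊥-elim (none (h , sh , opposite))
    ...   | inj₂ (inj₂ (inj₂ 0≤bal))       = 0≤* 0≤bal (<⇒≤ (support⇒> b sh))

-- Vertices of degree at most two

fresh : ∀ {k} (v u : Fin (3 ℕ.+ k)) → ∃[ w ] w ≢ v × w ≢ u
fresh zero          zero          = suc zero , (λ ()) , (λ ())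
fresh zero          (suc zero)    = suc (suc zero) , (λ ()) , (λ ())
fresh zero          (suc (suc _)) = suc zero , (λ ()) , (λ ())
fresh (suc zero)    zero          = suc (suc zero) , (λ ()) , (λ ())
fresh (suc (suc _)) zero          = suc zero , (λ ()) , (λ ())
fresh (suc _)       (suc _)       = zero , (λ ()) , (λ ())

#3 : Fin 4
#3 = suc (suc (suc zero))

-- The classes 0, 1, 2, 3 stand for v, u, w and the remaining vertices. An edge is counted at most
-- as often by the cuts of X and v as by those of u and w, unless it runs from v to the remaining
-- vertices.
class-cuts : ∀ (x y : Fin 4) → (x ≡ zero × y ≡ #3) ⊎ (x ≡ #3 × y ≡ zero) ⊎
  𝟙 (not (#3 == x) xor not (#3 == y)) + 𝟙 (joins x y zero) ≤ 𝟙 (joins x y (suc zero)) + 𝟙 (joins x y (suc (suc zero)))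
class-cuts = from-yes (Fₚ.all? λ (x : Fin 4) → Fₚ.all? λ (y : Fin 4) →
  ((x F.≟ zero) ×-dec (y F.≟ #3)) ⊎-dec (((x F.≟ #3) ×-dec (y F.≟ zero)) ⊎-dec
  (𝟙 (not (#3 == x) xor not (#3 == y)) + 𝟙 (joins x y zero) ≤? 𝟙 (joins x y (suc zero)) + 𝟙 (joins x y (suc (suc zero))))))

module Triple {k} (v u w : Fin k) (u≢v : u ≢ v) (w≢v : w ≢ v) (w≢u : w ≢ u) where

  X : Subset k
  X x = (v == x) ∨ ((u == x) ∨ (w == x))

  -- Reduces statements about u, v, w and any other vertex to checks over Fin 4.
  class : Fin k → Fin 4
  class x = if v == x then zero else if u == x then suc zero else if w == x then suc (suc zero) else #3

  class-v : ∀ x → (v == x) ≡ (zero == class x)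
  class-v x with v F.≟ x | u F.≟ x | w F.≟ x
  ... | yes _ | _     | _     = refl
  ... | no _  | yes _ | _     = refl
  ... | no _  | no _  | yes _ = refl
  ... | no _  | no _  | no _  = refl

  class-u : ∀ x → (u == x) ≡ (suc zero == class x)
  class-u x with v F.≟ x | u F.≟ x | w F.≟ x
  ... | yes refl | yes u≡v | _     = ⊥-elim (u≢v u≡v)
  ... | yes _    | no _    | _     = refl
  ... | no _     | yes _   | _     = refl
  ... | no _     | no _    | yes _ = refl
  ... | no _     | no _    | no _  = refl

  class-w : ∀ x → (w == x) ≡ (suc (suc zero) == class x)
  class-w x with v F.≟ x | u F.≟ x | w F.≟ x
  ... | yes refl | _        | yes w≡v = ⊥-elim (w≢v w≡v)
  ... | yes _    | _        | no _    = refl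
  ... | no _     | yes refl | yes w≡u = ⊥-elim (w≢u w≡u)
  ... | no _     | yes _    | no _    = refl
  ... | no _     | no _     | yes _   = refl
  ... | no _     | no _     | no _    = refl

  class-X : ∀ x → X x ≡ not (#3 == class x)
  class-X x with v F.≟ x | u F.≟ x | w F.≟ x
  ... | yes _ | _     | _     = refl
  ... | no _  | yes _ | _     = refl
  ... | no _  | no _  | yes _ = refl
  ... | no _  | no _  | no _  = refl

  card-X : card X ≡ 3
  card-X = trans (card-without X v Xv) (cong suc (trans (card-without (X without v) u Xu)
    (cong suc (card-singleton {S = (X without v) without u} w Xw only))))
    where
    Xv : X v ≡ true
    Xv = cong (_∨ ((u == v) ∨ (w == v))) (==-refl v)
    Xu : (X without v) u ≡ true
    Xu = trans (without-other X u≢v) (trans (cong (λ t → (v == u) ∨ (t ∨ (w == u))) (==-refl u)) (Boolₚ.∨-zeroʳ (v == u)))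
    Xw : ((X without v) without u) w ≡ true
    Xw = trans (without-other (X without v) w≢u) (trans (without-other X w≢v)
      (trans (cong (λ t → (v == w) ∨ ((u == w) ∨ t)) (==-refl w))
        (trans (cong ((v == w) ∨_) (Boolₚ.∨-zeroʳ (u == w))) (Boolₚ.∨-zeroʳ (v == w)))))
    only : ∀ x → ((X without v) without u) x ≡ true → x ≡ w
    only x eq with v F.≟ x | u F.≟ x | w F.≟ x
    ... | no _  | no _  | yes refl = refl
    ... | no _  | no _  | no _     = case eq of λ ()
    ... | no _  | yes _ | yes _    = case eq of λ ()
    ... | no _  | yes _ | no _     = case eq of λ ()
    ... | yes _ | yes _ | yes _    = case eq of λ ()
    ... | yes _ | yes _ | no _     = case eq of λ ()
    ... | yes _ | no _  | yes _    = case eq of λ ()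
    ... | yes _ | no _  | no _     = case eq of λ ()

  class-end : ∀ {x} → x ≡ u ⊎ x ≡ w → class x ≢ #3
  class-end (inj₁ refl) eq = case trans (sym (==-refl u)) (trans (class-u u) (cong (suc zero ==_) eq)) of λ ()
  class-end (inj₂ refl) eq = case trans (sym (==-refl w)) (trans (class-w w) (cong (suc (suc zero) ==_) eq)) of λ ()

  class-start : ∀ {x} → class x ≡ zero → x ≡ v
  class-start {x} eq = sym (==⇒≡ (trans (class-v x) (cong (zero ==_) eq)))

  -- If all neighbours of v lie in {u , w} then δ(X) ∪ δ(v) is covered by δ(u) and δ(w),
  -- so δ(X) has weight at most 1 + 1 - 1.
  tight : ∀ {m} (G : Multigraph k m) {b} → Feasible G b → 
    (∀ h → 0ℚ < b h → (proj₁ (G h) ≡ v → proj₂ (G h) ≡ u ⊎ proj₂ (G h) ≡ w) ×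
                       (proj₂ (G h) ≡ v → proj₁ (G h) ≡ u ⊎ proj₁ (G h) ≡ w)) →
    weight G b X ≡ 1ℚ
  tight {m} G {b} feas neighbours = ≤-antisym
    (≤-slack (1ℚ + 1ℚ - (weight G b X + 1ℚ)) (0≤-diff bound) (regroup (weight G b X)))
    (oddcut X (cong par card-X))
    where
    open Feasible feas
    regroup : ∀ x → 1ℚ ≡ x + (1ℚ + 1ℚ - (x + 1ℚ))
    regroup = solve-∀ ℚ-ring
    pointwise : ∀ h → χ (δ G X) h * b h + χ (δ G (v ==_)) h * b h ≤ χ (δ G (u ==_)) h * b h + χ (δ G (w ==_)) h * b h
    pointwise h with 0ℚ <? b h
    ... | no ≮bh = ≤-reflexive (trans (cong (λ y → χ (δ G X) h * y + χ (δ G (v ==_)) h * y) bh≡0)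
            (trans (zeros (χ (δ G X) h) (χ (δ G (v ==_)) h) (χ (δ G (u ==_)) h) (χ (δ G (w ==_)) h))
              (cong (λ y → χ (δ G (u ==_)) h * y + χ (δ G (w ==_)) h * y) (sym bh≡0))))
      where
      bh≡0 : b h ≡ 0ℚ
      bh≡0 = ≤-antisym (≮⇒≥ ≮bh) (nonneg h)
      zeros : ∀ x y z t → x * 0ℚ + y * 0ℚ ≡ z * 0ℚ + t * 0ℚ
      zeros = solve-∀ ℚ-ring
    ... | yes 0<bh = subst₂ _≤_ (*-distribʳ-+ (b h) (χ (δ G X) h) (χ (δ G (v ==_)) h))
            (*-distribʳ-+ (b h) (χ (δ G (u ==_)) h) (χ (δ G (w ==_)) h))
            (*-monoʳ-≤-nonNeg (b h) ⦃ nonNegative (nonneg h) ⦄ indicators)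
      where
      p = proj₁ (G h)
      q = proj₂ (G h)
      indicators : χ (δ G X) h + χ (δ G (v ==_)) h ≤ χ (δ G (u ==_)) h + χ (δ G (w ==_)) h
      indicators with class-cuts (class p) (class q)
      ... | inj₁ (p0 , q3)        = ⊥-elim (class-end (proj₁ (neighbours h 0<bh) (class-start p0)) q3)
      ... | inj₂ (inj₁ (p3 , q0)) = ⊥-elim (class-end (proj₂ (neighbours h 0<bh) (class-start q0)) p3)
      ... | inj₂ (inj₂ le) = subst₂ _≤_
        (sym (cong₂ _+_ (cong 𝟙 (cong₂ _xor_ (class-X p) (class-X q))) (cong 𝟙 (cong₂ _xor_ (class-v p) (class-v q)))))
        (sym (cong₂ _+_ (cong 𝟙 (cong₂ _xor_ (class-u p) (class-u q))) (cong 𝟙 (cong₂ _xor_ (class-w p) (class-w q)))))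
        le
    bound : weight G b X + 1ℚ ≤ 1ℚ + 1ℚ
    bound = subst₂ _≤_
      (trans (sum-+ (λ h → χ (δ G X) h * b h) (λ h → χ (δ G (v ==_)) h * b h)) (cong (weight G b X +_) (degree v)))
      (trans (sum-+ (λ h → χ (δ G (u ==_)) h * b h) (λ h → χ (δ G (w ==_)) h * b h)) (cong₂ _+_ (degree u) (degree w)))
      (sum-mono pointwise)

low-degree-cut : ∀ {k m} (G : Multigraph (3 ℕ.+ k) m) {b} → Feasible G b → ∀ v →
  card (λ e → support b e ∧ δ G (v ==_) e) ℕ.≤ 2 →
  ∃[ X ] card X ≡ 3 × weight G b X ≡ 1ℚ
low-degree-cut {k} {m} G {b} feas v low with positive-edge G b (Feasible.nonneg feas) (v ==_) (Feasible.degree feas v)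
... | e₁ , at₁ with card≤2⇒pair (λ e → support b e ∧ δ G (v ==_) e) e₁ at₁ low
...   | e₂ , pair = X , card-X , tight G feas neighbours
  where
  other : Fin m → Fin (3 ℕ.+ k)
  other h = if v == proj₁ (G h) then proj₂ (G h) else proj₁ (G h)
  other₁ : ∀ h → proj₁ (G h) ≡ v → proj₂ (G h) ≡ other h
  other₁ h refl rewrite ==-refl (proj₁ (G h)) = refl
  other₂ : ∀ h → 0ℚ < b h → proj₂ (G h) ≡ v → proj₁ (G h) ≡ other h
  other₂ h 0<bh refl rewrite ≢⇒== (≢-sym (support-loopless feas h 0<bh)) = refl
  u₂ : Fin (3 ℕ.+ k)
  u₂ = other e₂
  u : Fin (3 ℕ.+ k)
  u = other e₁
  u≢v : u ≢ v
  u≢v with v F.≟ proj₁ (G e₁)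
  ... | yes refl = ≢-sym (support-loopless feas e₁ (support⇒> b (proj₁ (∧-true at₁))))
  ... | no  v≢p  = ≢-sym v≢p
  choice : ∃[ w ] w ≢ v × w ≢ u × (u₂ ≢ v → u₂ ≡ u ⊎ u₂ ≡ w)
  choice with u₂ F.≟ v | u₂ F.≟ u
  ... | no u₂≢v | no u₂≢u = u₂ , u₂≢v , u₂≢u , λ _ → inj₂ refl
  -- Here and in the next case the second edge leads to no further neighbour of v, and an arbitrary
  -- third vertex completes the triple.
  ... | yes u₂≡v | _ = let w , w≢v , w≢u = fresh v u in w , w≢v , w≢u , λ u₂≢v → ⊥-elim (u₂≢v u₂≡v)
  ... | no _ | yes u₂≡u = let w , w≢v , w≢u = fresh v u in w , w≢v , w≢u , λ _ → inj₁ u₂≡u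
  w = proj₁ choice
  open Triple v u w u≢v (proj₁ (proj₂ choice)) (proj₁ (proj₂ (proj₂ choice)))
  located : ∀ {x h} → x ≡ other h → x ≢ v → h ≡ e₁ ⊎ h ≡ e₂ → x ≡ u ⊎ x ≡ w
  located refl _   (inj₁ refl) = inj₁ refl
  located refl x≢v (inj₂ refl) = proj₂ (proj₂ (proj₂ choice)) x≢v
  neighbours : ∀ h → 0ℚ < b h → (proj₁ (G h) ≡ v → proj₂ (G h) ≡ u ⊎ proj₂ (G h) ≡ w) ×
                                 (proj₂ (G h) ≡ v → proj₁ (G h) ≡ u ⊎ proj₁ (G h) ≡ w)
  neighbours h 0<bh = from₁ , from₂
    where
    p≢q = support-loopless feas h 0<bh
    from₁ : proj₁ (G h) ≡ v → proj₂ (G h) ≡ u ⊎ proj₂ (G h) ≡ w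
    from₁ p≡v = located (other₁ h p≡v) (λ q≡v → p≢q (trans p≡v (sym q≡v)))
      (pair h (cong₂ _∧_ (>⇒support b 0<bh) (cong₂ _xor_ (trans (cong (v ==_) p≡v) (==-refl v))
        (≢⇒== (λ v≡q → p≢q (trans p≡v v≡q))))))
    from₂ : proj₂ (G h) ≡ v → proj₁ (G h) ≡ u ⊎ proj₁ (G h) ≡ w
    from₂ q≡v = located (other₂ h 0<bh q≡v) (λ p≡v → p≢q (trans p≡v (sym q≡v)))
      (pair h (cong₂ _∧_ (>⇒support b 0<bh) (cong₂ _xor_ (≢⇒== (λ v≡p → p≢q (trans (sym v≡p) (sym q≡v))))
        (trans (cong (v ==_) q≡v) (==-refl v)))))

-- The handshake lemma, as an inequality because a loop lies in no star.
degree-sum : ∀ {k m} (G : Multigraph k m) (S : Subset m) →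
  sumℕ (λ v → card (λ e → S e ∧ δ G (v ==_) e)) ℕ.≤ card S ℕ.+ card S
degree-sum {k} G S = subst₂ ℕ._≤_ (sym (sumℕ-swap (λ v e → [ S e ∧ δ G (v ==_) e ]ℕ)))
  (sumℕ-+ (λ e → [ S e ]ℕ) (λ e → [ S e ]ℕ)) (sumℕ-mono two-ends)
  where
  one : ∀ (p : Fin k) → card (_== p) ≡ 1
  one p = card-singleton p (==-refl p) (λ _ → ==⇒≡)
  xor≤ : ∀ s t → [ s xor t ]ℕ ℕ.≤ [ s ]ℕ ℕ.+ [ t ]ℕ
  xor≤ false t     = ℕₚ.≤-refl
  xor≤ true  false = ℕₚ.≤-refl
  xor≤ true  true  = ℕ.z≤n
  two-ends : ∀ e → card (λ v → S e ∧ δ G (v ==_) e) ℕ.≤ [ S e ]ℕ ℕ.+ [ S e ]ℕ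
  two-ends e with S e
  ... | false = ℕₚ.≤-reflexive (card-empty {k} (λ _ → refl))
  ... | true  = subst (card (λ v → δ G (v ==_) e) ℕ.≤_)
    (trans (sumℕ-+ (λ v → [ v == proj₁ (G e) ]ℕ) (λ v → [ v == proj₂ (G e) ]ℕ))
           (cong₂ ℕ._+_ (one (proj₁ (G e))) (one (proj₂ (G e)))))
    (sumℕ-mono (λ v → xor≤ (v == proj₁ (G e)) (v == proj₂ (G e))))

-- Counting ends gives 3k ≤ 2|S|, impossible for |S| ≤ k when k is positive. The strict bound is
-- what `kernel` asks for against k degree equations.
many-edges-of-degree : ∀ {k m} (G : Multigraph k m) (S : Subset m) → 0 ℕ.< k →
  (∀ v → 3 ℕ.≤ card (λ e → S e ∧ δ G (v ==_) e)) → k ℕ.< card S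
many-edges-of-degree {k} G S 0<k deg≥3 = ℕₚ.≰⇒> too-few
  where
  3k≤2S : k ℕ.* 3 ℕ.≤ card S ℕ.+ card S
  3k≤2S = ℕₚ.≤-trans (subst (ℕ._≤ sumℕ (λ v → card (λ e → S e ∧ δ G (v ==_) e))) (sumℕ-const k 3) (sumℕ-mono deg≥3))
    (degree-sum G S)
  too-few : ¬ card S ℕ.≤ k
  too-few S≤k = ℕₚ.<-irrefl refl (ℕₚ.<-≤-trans 2k<3k (ℕₚ.≤-trans 3k≤2S (ℕₚ.+-mono-≤ S≤k S≤k)))
    where
    2k<3k : k ℕ.+ k ℕ.< k ℕ.* 3
    2k<3k = subst (k ℕ.+ k ℕ.<_) (trans (cong (λ x → k ℕ.+ (k ℕ.+ x)) (sym (ℕₚ.+-identityʳ k))) (ℕₚ.*-comm 3 k))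
      (ℕₚ.+-monoʳ-< k (subst (ℕ._< k ℕ.+ k) (ℕₚ.+-identityʳ k) (ℕₚ.+-monoʳ-< k 0<k)))

-- Edmonds' perfect matching polytope theorem, in the form of linear optimisation

edmonds : ∀ {k m} → Acc ℕ._<_ k → 0 ℕ.< k → par k ≡ false → (G : Multigraph k m) → ∀ {b} →
  Feasible G b → DecomposableFor G b
edmonds {k} {m} (acc smaller) 0<k even G feas = by-support (<-wellFounded _) feas
  where
  module S = Step G even (λ 0<j j<k evenj H feasH → edmonds (smaller j<k) 0<j evenj H feasH)

  -- The order is analysed through an equation, so that G and the module built on it stay fixed
  -- during the case distinction.
  step : ∀ j → k ≡ j → ∀ {b} → Feasible G b → S.FewerPositive b → DecomposableFor G b
  step zero refl feas fewer = case 0<k of λ ()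
  step (suc zero) refl feas fewer = case even of λ ()
  step (suc (suc zero)) refl feas fewer =
    let M , sup = matching-2 G feas in S.via-matching feas fewer M sup
  step (suc (suc (suc zero))) refl feas fewer = case even of λ ()
  step (suc (suc (suc (suc zero)))) refl feas fewer =
    let M , sup = two-edge-matching four-balanced four-oppositeOrHeavy zero G feas in S.via-matching feas fewer M sup
  step (suc (suc (suc (suc (suc j))))) refl {b} feas fewer
    with Fₚ.any? (λ v → card (λ e → support b e ∧ δ G (v ==_) e) ℕₚ.≤? 2)
  ... | yes (v , low) = let X , card-X , tight = low-degree-cut G feas v low in
    -- The complement of the three vertices is not a single vertex, as k is at least 5.
    S.tight-cut feas X (cong par card-X) (λ one → case trans (sym card-X) one of λ ())
      (λ one → big (trans (sym (cong₂ ℕ._+_ card-X one)) (card-complement X))) tight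
    where
    big : 4 ≢ 5 ℕ.+ j
    big ()
  ... | no none = S.many-edges feas fewer (many-edges-of-degree G (support b) 0<k
    (λ v → ℕₚ.≰⇒> (λ low → none (v , low))))

  by-support : ∀ {b} → Acc ℕ._<_ (card (support b)) → Feasible G b → DecomposableFor G b
  by-support (acc fewer) feas = step k refl feas (λ feas′ lt → by-support (fewer lt) feas′)

-- From the polytope theorem to the two linear programs

𝟙≥0 : ∀ t → 0ℚ ≤ 𝟙 t
𝟙≥0 true  = <⇒≤ 0<1
𝟙≥0 false = ≤-refl

-- By parity the matching meets the cut in an odd number of edges, hence in at least one.
perfect-odd-cut : ∀ {k m} (G : Multigraph k m) {M} → Perfect G M → ∀ X → par (card X) ≡ true →
  1ℚ ≤ weight G (χ M) X
perfect-odd-cut G {M} pm X odd = crossing (nonempty (λ e → M e ∧ δ G X e) (odd-positive _ (trans (perfect-parity G pm X) odd)))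
  where
  odd-positive : ∀ c → par c ≡ true → 0 ℕ.< c
  odd-positive (suc c) _ = ℕ.s≤s ℕ.z≤n
  crossing : ∃[ e ] M e ∧ δ G X e ≡ true → 1ℚ ≤ weight G (χ M) X
  crossing (e , eq) = let Me , De = ∧-true {M e} {δ G X e} eq in subst (_≤ weight G (χ M) X)
    (cong₂ (λ s t → 𝟙 s * 𝟙 t) De Me)
    (term≤sum (λ h → 0≤* (𝟙≥0 (δ G X h)) (𝟙≥0 (M h))) e)

-- The parity lemma for the set of all vertices, whose cut is empty.
perfect⇒even : ∀ {k m} (G : Multigraph k m) {M} → Perfect G M → par k ≡ false
perfect⇒even {k} G {M} pm = trans (cong par (sym (card-full k)))
  (trans (sym (perfect-parity G pm (λ _ → true))) (cong par (card-empty (λ e → Boolₚ.∧-zeroʳ (M e)))))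

qdot≡dot : ∀ {m} (S : Subset m) y → qdot S y ≡ dot (χ S) y
qdot≡dot S y = sum-cong pointwise
  where
  pointwise : ∀ e → (if S e then y e else 0ℚ) ≡ χ S e * y e
  pointwise e with S e
  ... | true  = sym (*-identityˡ (y e))
  ... | false = sym (*-zeroˡ (y e))

-- Disjunction and exclusive disjunction differ only if both ends equal v, which `loopless`
-- excludes.
incident≡δ : ∀ {n m} (G : Graph n m) v e → incident G e v ≡ δ (ends G) (v ==_) e
incident≡δ G v e with v F.≟ proj₁ (ends G e) | v F.≟ proj₂ (ends G e)
... | yes v≡p | yes v≡q = ⊥-elim (loopless G e (trans (sym v≡p) v≡q))
... | yes _   | no  _   = refl
... | no  _   | yes _   = refl
... | no  _   | no  _   = refl

star-weight : ∀ {n m} (G : Graph n m) v b → qdot (star G v) b ≡ weight (ends G) b (v ==_)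
star-weight G v b = trans (qdot≡dot (star G v) b) (dot-cong {y = b} (λ e → cong 𝟙 (incident≡δ G v e)) (λ _ → refl))

toPerfect : ∀ {n m} (G : Graph n m) {M} → IsPerfectMatching G M → Perfect (ends G) M
toPerfect G {M} pm v = trans (card-cong (λ e → cong (M e ∧_) (sym (incident≡δ G v e)))) (pm v)

fromPerfect : ∀ {n m} (G : Graph n m) {M} → Perfect (ends G) M → IsPerfectMatching G M
fromPerfect G {M} pm v = trans (card-cong (λ e → cong (M e ∧_) (incident≡δ G v e))) (pm v)

card-rest : ∀ {n} (X : Subset n) → n ℕ.∸ card X ≡ card (λ v → not (X v))
card-rest {n} X = trans (cong (ℕ._∸ card X) (sym (card-complement X))) (ℕₚ.m+n∸m≡n (card X) _)

-- Odd sets with a trivial cut get weight exactly 1 from the star equations. For the others, n being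
-- even makes the complement odd too, as the cut condition of (LP) requires.
LFeasible⇒Feasible : ∀ {n m} (G : Graph n m) {z b} → par n ≡ false → LFeasible G (z , b) → Feasible (ends G) b
LFeasible⇒Feasible {n} G {z} {b} even (_ , stars , cuts , b≥0) = record
  { nonneg = b≥0
  ; noloop = λ e loop → ⊥-elim (loopless G e loop)
  ; degree = degree
  ; oddcut = oddcut
  }
  where
  degree : ∀ v → weight (ends G) b (v ==_) ≡ 1ℚ
  degree v = trans (sym (star-weight G v b)) (stars v)
  oddcut : ∀ X → par (card X) ≡ true → 1ℚ ≤ weight (ends G) b X
  oddcut X odd with card X ℕₚ.≟ 1 | card (λ v → not (X v)) ℕₚ.≟ 1
  ... | yes one | _       = ≤-reflexive (sym (weight-singleton (ends G) b degree X one))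
  ... | no  _   | yes one = ≤-reflexive (sym (weight-cosingleton (ends G) b degree X one))
  ... | no X≢1  | no X̄≢1  = subst (1ℚ ≤_) (qdot≡dot (cut G X) b) (cuts X
    ( par⇒Odd (card X) odd
    , par⇒Odd (n ℕ.∸ card X) (trans (cong par (card-rest X)) (odd-complement X even odd))
    , X≢1
    , λ one → X̄≢1 (trans (sym (card-rest X)) one)))

-- The vertex `v₀` forces every perfect matching to have an edge, which is the hypothesis `A-big` of
-- strong duality. `M₀` makes the optimal value T positive, so that it can be inverted.
module Duality {n m} (G : Graph n m) (v₀ : Fin n) (M₀ : Subset m) (pm₀ : Perfect (ends G) M₀) where

  choose : (M : Subset m) → Dec (Perfect (ends G) M) → ∃ (Perfect (ends G))
  choose M (yes pm) = M , pm
  choose M (no _)   = M₀ , pm₀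

  -- Indices of sets that are not perfect matchings repeat M₀.
  matchingAt : Fin (2 ℕ.^ m) → ∃ (Perfect (ends G))
  matchingAt i = choose (subsetAt i) (perfect? (ends G) (subsetAt i))

  matchingAt-indexOf : ∀ M → Perfect (ends G) M → ∀ e → proj₁ (matchingAt (indexOf M)) e ≡ M e
  matchingAt-indexOf M pm e with perfect? (ends G) (subsetAt (indexOf M))
  ... | yes _  = subsetAt-indexOf M e
  ... | no ¬pm = ⊥-elim (¬pm (perfect-cong (ends G) (λ h → sym (subsetAt-indexOf M h)) pm))

  A : Fin (2 ℕ.^ m) → Point m
  A i = χ (proj₁ (matchingAt i))

  size≥1 : ∀ {M} → Perfect (ends G) M → 1ℚ ≤ sumℚ (χ M)
  size≥1 {M} pm with cut-edge M (δ (ends G) (v₀ ==_)) (pm v₀)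
  ... | e , Me , _ = subst (_≤ sumℚ (χ M)) (cong 𝟙 Me) (term≤sum (λ h → 𝟙≥0 (M h)) e)

  open StrongDuality A (λ i → size≥1 (proj₂ (matchingAt i)))
  open Optimum optimum

  T : ℚ
  T = sumℚ primal

  row-value : ∀ y i → MpfFeasible G y → 1ℚ ≤ dot (A i) y
  row-value y i (covers , _) = subst (1ℚ ≤_) (qdot≡dot (proj₁ (matchingAt i)) y)
    (covers (proj₁ (matchingAt i)) (fromPerfect G (proj₂ (matchingAt i))))

  primal-covers : ∀ M → Perfect (ends G) M → 1ℚ ≤ dot (χ M) primal
  primal-covers M pm = subst (1ℚ ≤_)
    (dot-cong {y = primal} (λ e → cong 𝟙 (matchingAt-indexOf M pm e)) (λ _ → refl)) (primal-feasible (indexOf M))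

  mpf-feasible : MpfFeasible G primal
  mpf-feasible = (λ M pm → subst (1ℚ ≤_) (sym (qdot≡dot M primal)) (primal-covers M (toPerfect G pm))) , primal≥0

  weak-duality : ∀ y → MpfFeasible G y → sumℚ dual ≤ sumℚ y
  weak-duality y feas = begin
    sumℚ dual                         ≡⟨ sym (dot-1ʳ dual) ⟩
    dot dual (λ _ → 1ℚ)               ≤⟨ dot-monoʳ dual≥0 (λ i → row-value y i feas) ⟩
    dot dual (λ i → dot (A i) y)      ≡⟨ sym (dot-sumˡ dual A y) ⟩
    dot (column dual) y               ≡⟨ dot-comm (column dual) y ⟩
    dot y (column dual)               ≤⟨ dot-monoʳ (proj₂ feas) dual-feasible ⟩
    dot y (λ _ → 1ℚ)                  ≡⟨ dot-1ʳ y ⟩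
    sumℚ y                            ∎
    where open ≤-Reasoning

  Σdual≡T : sumℚ dual ≡ T
  Σdual≡T = ≤-antisym (weak-duality primal mpf-feasible) no-gap

  mpf-optimal : IsOptimalValue (MpfFeasible G) mpfObjective T
  mpf-optimal = (primal , mpf-feasible , refl) , λ y feas → ≤-trans no-gap (weak-duality y feas)

  0<T : 0ℚ < T
  0<T = <-≤-trans 0<1 (≤-trans (primal-covers M₀ pm₀) (sum-mono le))
    where
    le : ∀ e → χ M₀ e * primal e ≤ primal e
    le e with M₀ e
    ... | true  = ≤-reflexive (*-identityˡ (primal e))
    ... | false = subst (_≤ primal e) (sym (*-zeroˡ (primal e))) (primal≥0 e)

  r : ℚ
  r = proj₁ (reciprocal-pos T 0<T)

  Tr≡1 : T * r ≡ 1ℚ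
  Tr≡1 = proj₁ (proj₂ (reciprocal-pos T 0<T))

  0<r : 0ℚ < r
  0<r = proj₂ (proj₂ (reciprocal-pos T 0<T))

  r*-mono : ∀ {p q} → p ≤ q → r * p ≤ r * q
  r*-mono = *-monoˡ-≤-nonNeg r ⦃ nonNegative (<⇒≤ 0<r) ⦄

  average : Point m
  average e = r * column dual e

  r*Σdual≡1 : r * dot dual (λ _ → 1ℚ) ≡ 1ℚ
  r*Σdual≡1 = trans (cong (r *_) (trans (dot-1ʳ dual) Σdual≡T)) (trans (*-comm r T) Tr≡1)

  average-weight : ∀ X → weight (ends G) average X ≡ r * dot dual (λ i → weight (ends G) (A i) X)
  average-weight X = trans (dot-scaleʳ r (χ (δ (ends G) X)) (column dual)) (cong (r *_)
    (trans (dot-comm (χ (δ (ends G) X)) (column dual))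
      (trans (dot-sumˡ dual A (χ (δ (ends G) X)))
        (dot-cong {x = dual} (λ _ → refl) (λ i → dot-comm (A i) (χ (δ (ends G) X)))))))

  average-feasible : LFeasible G (r , average)
  average-feasible =
      (λ e → subst (average e ≤_) (*-identityʳ r) (r*-mono (dual-feasible e)))
    , (λ v → trans (star-weight G v average) (trans (average-weight (v ==_)) (trans
        (cong (r *_) (dot-cong {x = dual} (λ _ → refl) (λ i → perfect-degree (ends G) (proj₂ (matchingAt i)) v)))
        r*Σdual≡1)))
    , (λ X (odd , _) → subst₂ _≤_ r*Σdual≡1
        (trans (sym (average-weight X)) (sym (qdot≡dot (cut G X) average)))
        (r*-mono (dot-monoʳ dual≥0 (λ i →
          perfect-odd-cut (ends G) (proj₂ (matchingAt i)) X (Odd⇒par (card X) odd)))))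
    , (λ e → 0≤* (<⇒≤ 0<r) (sum-≥0 (λ i → 0≤* (dual≥0 i) (𝟙≥0 (proj₁ (matchingAt i) e)))))

  r-minimal : ∀ x → LFeasible G x → r ≤ LObjective x
  r-minimal (z , b) feas = conclude
    (edmonds (<-wellFounded n) 0<n even (ends G) (LFeasible⇒Feasible G even feas) primal)
    where
    even : par n ≡ false
    even = perfect⇒even (ends G) pm₀
    0<n : 0 ℕ.< n
    0<n = ℕₚ.≤-<-trans ℕ.z≤n (Fₚ.toℕ<n v₀)
    conclude : ∃[ M ] Supported (ends G) b M × dot (χ M) primal ≤ dot b primal → r ≤ z
    conclude (M , (pm , _) , le) = begin
      r               ≡⟨ sym (*-identityʳ r) ⟩
      r * 1ℚ          ≤⟨ r*-mono 1≤zT ⟩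
      r * (z * T)     ≡⟨ regroup r z T ⟩
      z * (T * r)     ≡⟨ cong (z *_) Tr≡1 ⟩
      z * 1ℚ          ≡⟨ *-identityʳ z ⟩
      z               ∎
      where
      open ≤-Reasoning
      regroup : ∀ x y t → x * (y * t) ≡ y * (t * x)
      regroup = solve-∀ ℚ-ring
      1≤zT : 1ℚ ≤ z * T
      1≤zT = begin
        1ℚ                        ≤⟨ primal-covers M pm ⟩
        dot (χ M) primal          ≤⟨ le ⟩
        dot b primal              ≡⟨ dot-comm b primal ⟩
        dot primal b              ≤⟨ dot-monoʳ primal≥0 (proj₁ feas) ⟩
        dot primal (λ _ → z)      ≡⟨ dot-comm primal (λ _ → z) ⟩
        dot (λ _ → z) primal      ≡⟨ dot-constˡ z primal ⟩
        z * T                     ∎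

  L-optimal : IsOptimalValue (LFeasible G) LObjective r
  L-optimal = ((r , average) , average-feasible , refl) , r-minimal

theorem2p5 : ∀ {n m} (G : Graph n m) → 0 ℕ.< n → HasPerfectMatching G →
    ∃₂ λ (mpf L : ℚ) →
    IsOptimalValue (MpfFeasible G) mpfObjective mpf ×
    IsOptimalValue (LFeasible G) LObjective L ×
    mpf * L ≡ 1ℚ
theorem2p5 G 0<n (M₀ , pm₀) = T , r , mpf-optimal , L-optimal , Tr≡1
  where open Duality G (F.fromℕ< 0<n) M₀ (toPerfect G pm₀)
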